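{- Let $a=(a_i)_{i\in\mathbb Z}$ be any sequence of complex numbers and $\widehat a$ its dual sequence. Then, with $H(u)=1+\sum_{k\ge1}h_ku^{ -k}$ and $E(v)=1+\sum_{k\ge1}e_kv^{ -k}$, $$1+(u+v)\sum_{p,q=0}^\infty\frac{s_{(p\mid q);a}}{(u-a_1)\cdots(u-a_{p+1})(v-\widehat a_1)\cdots(v-\widehat a_{q+1})}=H(u)E(v),$$ where $(p\mid q)$ is the hook diagram with Frobenius coordinates $p,q$ (i.e. the partition $(p+1,1^q)$), and both sides are regarded as formal series in $u^{ -1},v^{ -1}$ with coefficients in $\Lambda$.
   Context: $\Lambda$ is the algebra of symmetric functions over $\mathbb C$ with complete homogeneous $h_k$ and elementary $e_k$. For a sequence $a=(a_i)_{i\in\mathbb Z}$ define $h_{k;a}=\sum_{i=1}^k(-1)^{k-i}e_{k-i}(a_1,\dots,a_{k-1})h_i$ for $k\ge1$, $h_{0;a}=1$, $h_{k;a}=0$ for $k<0$; let $(\tau^ra)_i=a_{i+r}$; and set $s_{\mu;a}=\det[h_{\mu_i-i+j;\,\tau^{1-j}a}]_{i,j=1}^N$ for any $N\ge\ell(\mu)$. The dual sequence is $\widehat a_i=-a_{1-i}$. -}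

module Defs where

open import Level using (Level; _⊔_)
open import Algebra.Bundles using (CommutativeRing; RawRing; Semiring)
open import Data.Bool.Base using (if_then_else_)
open import Data.Fin.Base as Fin using (Fin; toℕ)
open import Data.Integer.Base as ℤ using (ℤ; +_; -[1+_])
open import Data.List.Base as List using (List; []; _∷_; _∷ʳ_; _++_)
open import Data.List.Relation.Binary.Permutation.Propositional using (_↭_; refl; prep; swap; trans; ↭-sym)
open import Data.List.Relation.Binary.Permutation.Propositional.Properties using (All-resp-↭)
open import Data.List.Relation.Unary.All using (All; []; _∷_; all?)
open import Data.Nat.Base as ℕ using (ℕ; zero; suc; z≤n)
open import Data.Nat.ListAction using (sum)
open import Data.Nat.ListAction.Properties using (sum-↭; sum-++)
import Data.Nat.Properties as ℕₚ
open import Data.Product.Base using (_×_; _,_; ∃-syntax)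
open import Data.Sum.Base using (_⊎_; inj₁; inj₂)
open import Data.Vec.Functional using (removeAt)
open import Function.Base using (_∘_)
open import Relation.Binary.PropositionalEquality as ≡ using (_≡_)
open import Relation.Nullary using (Dec; yes; no; does; contradiction; _×-dec_)

-- Determinant by expansion along the first column.
module Determinant {c ℓ : Level} (R : RawRing c ℓ) where
  open RawRing R
  open import Algebra.Definitions.RawMonoid +-rawMonoid using () renaming (sum to ∑)
  open import Algebra.Definitions.RawSemiring rawSemiring using (_^_)

  det : (n : ℕ) → (Fin n → Fin n → Carrier) → Carrier
  det zero    M = 1#
  det (suc n) M = ∑ λ i →
    (- 1#) ^ toℕ i * (M i Fin.zero * det n (λ k l → removeAt M i k (Fin.suc l)))

-- The Frobenius hook (p | q), as a list of parts.
hook : ℕ → ℕ → List ℕ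
hook p q = suc p ∷ List.replicate q 1

-- The (n+1)-st part of a partition, which is 0 beyond its length.
part : List ℕ → ℕ → ℕ
part []       n       = 0
part (x ∷ xs) zero    = x
part (x ∷ xs) (suc n) = part xs n

-- All sublists with k entries.
choose : {a : Level} {A : Set a} → ℕ → List A → List (List A)
choose zero    xs       = [] ∷ []
choose (suc k) []       = []
choose (suc k) (x ∷ xs) = List.map (x ∷_) (choose k xs) ++ choose (suc k) xs

module Symmetric {c ℓ : Level} (K : CommutativeRing c ℓ) where
  open CommutativeRing K renaming (Carrier to 𝕂) hiding (refl; sym; trans)
  private module K = CommutativeRing K
  open import Algebra.Definitions.RawMonoid +-rawMonoid using () renaming (sum to ∑)
  open import Algebra.Definitions.RawSemiring (Semiring.rawSemiring semiring) using (_^_)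
  open import Algebra.Properties.CommutativeMonoid.Sum +-commutativeMonoid
    using (sum-cong-≋; sum-replicate-zero; ∑-comm)
  open import Algebra.Properties.Ring ring using (-0#≈0#)

  -- Symmetric functions in x₁, x₂, … over 𝕂.  A list (m₁, …, mₙ) stands for the monomial x₁^m₁ ⋯ xₙ^mₙ,
  -- so appending zeros does not change the monomial.  A symmetric function
  -- is a formal power series of bounded degree, given by its coefficients,
  -- that is invariant under permutation of the variables.
  record Λ : Set (c ⊔ ℓ) where
    field
      coeff     : List ℕ → 𝕂
      stable    : ∀ xs → coeff (xs ∷ʳ 0) ≈ coeff xs
      symmetric : ∀ {xs ys} → xs ↭ ys → coeff xs ≈ coeff ys
      bounded   : ∃[ d ] (∀ xs → d ℕ.< sum xs → coeff xs ≈ 0#)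

  open Λ

  infix 4 _≈Λ_
  _≈Λ_ : Λ → Λ → Set ℓ
  f ≈Λ g = ∀ xs → coeff f xs ≈ coeff g xs

  0Λ : Λ
  0Λ = record
    { coeff     = λ _ → 0#
    ; stable    = λ _ → K.refl
    ; symmetric = λ _ → K.refl
    ; bounded   = 0 , λ _ _ → K.refl
    }

  infixl 6 _+Λ_
  _+Λ_ : Λ → Λ → Λ
  f +Λ g = record
    { coeff     = λ xs → coeff f xs + coeff g xs
    ; stable    = λ xs → +-cong (stable f xs) (stable g xs)
    ; symmetric = λ p → +-cong (symmetric f p) (symmetric g p)
    ; bounded   = let (d , f≈0) = bounded f ; (e , g≈0) = bounded g in
        d ℕ.+ e , λ xs lt → K.trans
          (+-cong (f≈0 xs (ℕₚ.≤-<-trans (ℕₚ.m≤m+n d e) lt))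
                  (g≈0 xs (ℕₚ.≤-<-trans (ℕₚ.m≤n+m e d) lt)))
          (+-identityˡ 0#)
    }

  infix 8 -Λ_
  -Λ_ : Λ → Λ
  -Λ f = record
    { coeff     = λ xs → - coeff f xs
    ; stable    = λ xs → -‿cong (stable f xs)
    ; symmetric = λ p → -‿cong (symmetric f p)
    ; bounded   = let (d , f≈0) = bounded f in
        d , λ xs lt → K.trans (-‿cong (f≈0 xs lt)) -0#≈0#
    }

  infixr 7 _•_
  _•_ : 𝕂 → Λ → Λ
  k • f = record
    { coeff     = λ xs → k * coeff f xs
    ; stable    = λ xs → *-congˡ (stable f xs)
    ; symmetric = λ p → *-congˡ (symmetric f p)
    ; bounded   = let (d , f≈0) = bounded f in
        d , λ xs lt → K.trans (*-congˡ (f≈0 xs lt)) (zeroʳ k)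
    }

  -- Coefficients of a product: the sum of f ys * g zs over all ways to write
  -- xs as an entrywise sum of ys and zs.
  conv : (List ℕ → 𝕂) → (List ℕ → 𝕂) → List ℕ → 𝕂
  conv f g []       = f [] * g []
  conv f g (x ∷ xs) = ∑ {suc x} λ i →
    conv (λ ys → f (toℕ i ∷ ys)) (λ zs → g (x ℕ.∸ toℕ i ∷ zs)) xs

  conv-cong : ∀ {f f′ g g′} → (∀ xs → f xs ≈ f′ xs) → (∀ xs → g xs ≈ g′ xs) →
              ∀ xs → conv f g xs ≈ conv f′ g′ xs
  conv-cong p q []       = *-cong (p []) (q [])
  conv-cong p q (x ∷ xs) = sum-cong-≋ {suc x} λ i →
    conv-cong (λ ys → p (toℕ i ∷ ys)) (λ zs → q (x ℕ.∸ toℕ i ∷ zs)) xs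

  conv-stable : ∀ {f g} → (∀ xs → f (xs ∷ʳ 0) ≈ f xs) → (∀ xs → g (xs ∷ʳ 0) ≈ g xs) →
                ∀ xs → conv f g (xs ∷ʳ 0) ≈ conv f g xs
  conv-stable p q []       = K.trans (+-identityʳ _) (*-cong (p []) (q []))
  conv-stable p q (x ∷ xs) = sum-cong-≋ {suc x} λ i →
    conv-stable (λ ys → p (toℕ i ∷ ys)) (λ zs → q (x ℕ.∸ toℕ i ∷ zs)) xs

  conv-symmetric : ∀ {f g} → (∀ {xs ys} → xs ↭ ys → f xs ≈ f ys) →
                   (∀ {xs ys} → xs ↭ ys → g xs ≈ g ys) →
                   ∀ {xs ys} → xs ↭ ys → conv f g xs ≈ conv f g ys
  conv-symmetric p q refl          = K.refl
  conv-symmetric p q (prep x r)    = sum-cong-≋ {suc x} λ i →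
    conv-symmetric (p ∘ prep (toℕ i)) (q ∘ prep (x ℕ.∸ toℕ i)) r
  conv-symmetric {f} {g} p q (swap {ys = ys} x y r) = K.trans
    (sum-cong-≋ {suc x} λ i → sum-cong-≋ {suc y} λ j → K.trans
      (conv-symmetric (p ∘ prep (toℕ i) ∘ prep (toℕ j))
        (q ∘ prep (x ℕ.∸ toℕ i) ∘ prep (y ℕ.∸ toℕ j)) r)
      (conv-cong (λ _ → p (swap _ _ refl)) (λ _ → q (swap _ _ refl)) ys))
    (∑-comm {suc x} {suc y} λ i j → conv (λ zs → f (toℕ j ∷ toℕ i ∷ zs))
      (λ zs → g (y ℕ.∸ toℕ j ∷ x ℕ.∸ toℕ i ∷ zs)) ys)
  conv-symmetric p q (trans r s)   = K.trans (conv-symmetric p q r) (conv-symmetric p q s)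

  conv-bounded : ∀ {f g} n → (∀ ys zs → n ℕ.≤ sum ys ℕ.+ sum zs → f ys * g zs ≈ 0#) →
                 ∀ xs → n ℕ.≤ sum xs → conv f g xs ≈ 0#
  conv-bounded n p []       le = p [] [] le
  conv-bounded n p (x ∷ xs) le = K.trans
    (sum-cong-≋ {suc x} λ i → conv-bounded (n ℕ.∸ x)
      (λ ys zs le′ → p (toℕ i ∷ ys) (x ℕ.∸ toℕ i ∷ zs) (bound i ys zs le′))
      xs (ℕₚ.m≤n+o⇒m∸n≤o n x le))
    (sum-replicate-zero (suc x))
    where
    open import Data.Fin.Properties using (toℕ≤pred[n])
    open import Data.Nat.Solver using (module +-*-Solver)
    open +-*-Solver
    bound : ∀ i ys zs → n ℕ.∸ x ℕ.≤ sum ys ℕ.+ sum zs →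
            n ℕ.≤ (toℕ {suc x} i ℕ.+ sum ys) ℕ.+ (x ℕ.∸ toℕ i ℕ.+ sum zs)
    bound i ys zs le′ = ℕₚ.≤-trans
      (ℕₚ.≤-trans (ℕₚ.m≤n+m∸n n x) (ℕₚ.+-monoʳ-≤ x le′)) (ℕₚ.≤-reflexive eq)
      where
      eq : x ℕ.+ (sum ys ℕ.+ sum zs) ≡ (toℕ i ℕ.+ sum ys) ℕ.+ (x ℕ.∸ toℕ i ℕ.+ sum zs)
      eq = ≡.trans
        (≡.cong (ℕ._+ (sum ys ℕ.+ sum zs)) (≡.sym (ℕₚ.m+[n∸m]≡n (toℕ≤pred[n] i))))
        (solve 4 (λ a b s t → (a :+ b) :+ (s :+ t) := (a :+ s) :+ (b :+ t)) ≡.refl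
          (toℕ i) (x ℕ.∸ toℕ i) (sum ys) (sum zs))

  infixl 7 _*Λ_
  _*Λ_ : Λ → Λ → Λ
  f *Λ g = record
    { coeff     = conv (coeff f) (coeff g)
    ; stable    = conv-stable (stable f) (stable g)
    ; symmetric = conv-symmetric (symmetric f) (symmetric g)
    ; bounded   = let (d , f≈0) = bounded f ; (e , g≈0) = bounded g in
        d ℕ.+ e , conv-bounded (suc (d ℕ.+ e)) (vanish d e f≈0 g≈0)
    }
    where
    vanish : ∀ d e → (∀ xs → d ℕ.< sum xs → coeff f xs ≈ 0#) →
             (∀ xs → e ℕ.< sum xs → coeff g xs ≈ 0#) →
             ∀ ys zs → d ℕ.+ e ℕ.< sum ys ℕ.+ sum zs → coeff f ys * coeff g zs ≈ 0#
    vanish d e f≈0 g≈0 ys zs lt with d ℕₚ.<? sum ys | e ℕₚ.<? sum zs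
    ... | yes p | _     = K.trans (*-congʳ (f≈0 ys p)) (zeroˡ _)
    ... | no  _ | yes q = K.trans (*-congˡ (g≈0 zs q)) (zeroʳ _)
    ... | no ¬p | no ¬q = contradiction lt
      (ℕₚ.≤⇒≯ (ℕₚ.+-mono-≤ (ℕₚ.≮⇒≥ ¬p) (ℕₚ.≮⇒≥ ¬q)))

  indicator : ∀ {p} {P : Set p} → Dec P → 𝕂
  indicator P? = if does P? then 1# else 0#

  indicator-cong : ∀ {p q} {P : Set p} {Q : Set q} (P? : Dec P) (Q? : Dec Q) →
                   (P → Q) → (Q → P) → indicator P? ≈ indicator Q?
  indicator-cong (yes _) (yes _) _ _ = K.refl
  indicator-cong (yes p) (no ¬q) f _ = contradiction (f p) ¬q
  indicator-cong (no ¬p) (yes q) _ g = contradiction (g q) ¬p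
  indicator-cong (no _)  (no _)  _ _ = K.refl

  indicator-no : ∀ {p} {P : Set p} (P? : Dec P) → (P → 0# ≈ 1#) → indicator P? ≈ 0#
  indicator-no (yes p) f = K.sym (f p)
  indicator-no (no _)  _ = K.refl

  private
    sum-∷ʳ : ∀ xs → sum (xs ∷ʳ 0) ≡ sum xs
    sum-∷ʳ xs = ≡.trans (sum-++ xs (0 ∷ [])) (ℕₚ.+-identityʳ _)

    squareFree? : ∀ xs → Dec (All (ℕ._≤ 1) xs)
    squareFree? = all? (ℕₚ._≤? 1)

    squareFree-∷ʳ : ∀ {xs} → All (ℕ._≤ 1) xs → All (ℕ._≤ 1) (xs ∷ʳ 0)
    squareFree-∷ʳ []       = z≤n ∷ []
    squareFree-∷ʳ (p ∷ ps) = p ∷ squareFree-∷ʳ ps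

    squareFree-∷ʳ⁻ : ∀ xs → All (ℕ._≤ 1) (xs ∷ʳ 0) → All (ℕ._≤ 1) xs
    squareFree-∷ʳ⁻ []       _        = []
    squareFree-∷ʳ⁻ (x ∷ xs) (p ∷ ps) = p ∷ squareFree-∷ʳ⁻ xs ps

  -- The sum of all monomials of degree k.
  hΛ : ℕ → Λ
  hΛ k = record
    { coeff     = λ xs → indicator (sum xs ℕₚ.≟ k)
    ; stable    = λ xs → indicator-cong (sum (xs ∷ʳ 0) ℕₚ.≟ k) (sum xs ℕₚ.≟ k)
                    (≡.trans (≡.sym (sum-∷ʳ xs))) (≡.trans (sum-∷ʳ xs))
    ; symmetric = λ {xs} {ys} p → indicator-cong (sum xs ℕₚ.≟ k) (sum ys ℕₚ.≟ k)
                    (≡.trans (≡.sym (sum-↭ p))) (≡.trans (sum-↭ p))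
    ; bounded   = k , λ xs lt → indicator-no (sum xs ℕₚ.≟ k)
                    (λ eq → contradiction (≡.sym eq) (ℕₚ.<⇒≢ lt))
    }

  -- The sum of all square-free monomials of degree k.
  eΛ : ℕ → Λ
  eΛ k = record
    { coeff     = λ xs → indicator (P? xs)
    ; stable    = λ xs → indicator-cong (P? (xs ∷ʳ 0)) (P? xs)
                    (λ (eq , sf) → ≡.trans (≡.sym (sum-∷ʳ xs)) eq , squareFree-∷ʳ⁻ xs sf)
                    (λ (eq , sf) → ≡.trans (sum-∷ʳ xs) eq , squareFree-∷ʳ sf)
    ; symmetric = λ {xs} {ys} p → indicator-cong (P? xs) (P? ys)
                    (λ (eq , sf) → ≡.trans (≡.sym (sum-↭ p)) eq , All-resp-↭ p sf)
                    (λ (eq , sf) → ≡.trans (sum-↭ p) eq , All-resp-↭ (↭-sym p) sf)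
    ; bounded   = k , λ xs lt → indicator-no (P? xs)
                    (λ (eq , _) → contradiction (≡.sym eq) (ℕₚ.<⇒≢ lt))
    }
    where
    P? : ∀ xs → Dec (sum xs ≡ k × All (ℕ._≤ 1) xs)
    P? xs = (sum xs ℕₚ.≟ k) ×-dec squareFree? xs

  1Λ : Λ
  1Λ = hΛ 0

  Λ-rawRing : RawRing (c ⊔ ℓ) ℓ
  Λ-rawRing = record
    { Carrier = Λ ; _≈_ = _≈Λ_ ; _+_ = _+Λ_ ; _*_ = _*Λ_ ; -_ = -Λ_ ; 0# = 0Λ ; 1# = 1Λ }

  open Determinant Λ-rawRing
  open import Algebra.Definitions.RawMonoid (RawRing.+-rawMonoid Λ-rawRing)
    using () renaming (sum to ∑Λ)

  Sequence : Set c
  Sequence = ℤ → 𝕂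

  τ : ℤ → Sequence → Sequence
  τ r a i = a (i ℤ.+ r)

  dual : Sequence → Sequence
  dual a i = - a (+ 1 ℤ.- i)

  -- The elementary symmetric polynomial eₖ evaluated at a list of scalars.
  elem : ℕ → List 𝕂 → 𝕂
  elem k xs = List.foldr _+_ 0# (List.map (List.foldr _*_ 1#) (choose k xs))

  -- a₁, …, aₙ
  initial : ℕ → Sequence → List 𝕂
  initial n a = List.applyUpTo (λ i → a (+ suc i)) n

  -- In the third clause k = suc m, and the summation index is suc (toℕ i).
  hₘ : ℤ → Sequence → Λ
  hₘ -[1+ _ ]  a = 0Λ
  hₘ (+ zero)  a = 1Λ
  hₘ (+ suc m) a = ∑Λ {suc m} λ i →
    ((- 1#) ^ (m ℕ.∸ toℕ i) * elem (m ℕ.∸ toℕ i) (initial m a)) • hΛ (suc (toℕ i))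

  -- The N × N determinant defining s_{μ;a}, for N at least the length of μ;
  -- rows and columns are numbered from 1.
  sₘ : ℕ → List ℕ → Sequence → Λ
  sₘ N μ a = det N λ i j → let i′ = + suc (toℕ i) ; j′ = + suc (toℕ j) in
    hₘ (+ part μ (toℕ i) ℤ.- i′ ℤ.+ j′) (τ (+ 1 ℤ.- j′) a)

  -- Series in t⁻¹ (t = u or v) over 𝕂 and over Λ; entry n is the coefficient
  -- of t⁻ⁿ.
  Series₁ : Set c
  Series₁ = ℕ → 𝕂

  Series₁Λ : Set (c ⊔ ℓ)
  Series₁Λ = ℕ → Λ

  one₁ : Series₁
  one₁ zero    = 1#
  one₁ (suc _) = 0#

  _*₁_ : Series₁ → Series₁ → Series₁
  (f *₁ g) n = ∑ {suc n} λ i → f (toℕ i) * g (n ℕ.∸ toℕ i)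

  -- 1 / (t - b) = ∑ₙ bⁿ t⁻ⁿ⁻¹
  geometric : 𝕂 → Series₁
  geometric b zero    = 0#
  geometric b (suc n) = b ^ n

  -- 1 / ((t - a₁) ⋯ (t - aₙ))
  inverseProduct : ℕ → Sequence → Series₁
  inverseProduct n a = List.foldr (λ b f → geometric b *₁ f) one₁ (initial n a)

  H E : Series₁Λ
  H zero    = 1Λ
  H (suc k) = hΛ (suc k)
  E zero    = 1Λ
  E (suc k) = eΛ (suc k)

  -- Doubly infinite series in u and v; the entry at i, j is the coefficient of
  -- u⁻ⁱ v⁻ʲ.  Negative i and j are kept so that multiplication by u and v is
  -- defined without discarding any term.
  Series₂ : Set (c ⊔ ℓ)
  Series₂ = ℤ → ℤ → Λ

  infix 4 _≈₂_
  _≈₂_ : Series₂ → Series₂ → Set ℓ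
  F ≈₂ G = ∀ i j → F i j ≈Λ G i j

  infixl 6 _+₂_
  _+₂_ : Series₂ → Series₂ → Series₂
  (F +₂ G) i j = F i j +Λ G i j

  u·_ v·_ : Series₂ → Series₂
  (u· F) i j = F (i ℤ.+ + 1) j
  (v· F) i j = F i (j ℤ.+ + 1)

  infixr 7 [u+v]·_
  [u+v]·_ : Series₂ → Series₂
  [u+v]· F = (u· F) +₂ (v· F)

  1₂ : Series₂
  1₂ (+ 0) (+ 0) = 1Λ
  1₂ _     _     = 0Λ

  -- f(u) g(v)
  infixl 7 _⊗_
  _⊗_ : Series₁Λ → Series₁Λ → Series₂
  (f ⊗ g) (+ i)    (+ j)    = f i *Λ g j
  (f ⊗ g) (+ _)    -[1+ _ ] = 0Λ
  (f ⊗ g) -[1+ _ ] _        = 0Λ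

  -- s · f(u) g(v)
  scaled : Λ → Series₁ → Series₁ → Series₂
  scaled s f g (+ i)    (+ j)    = (f i * g j) • s
  scaled s f g (+ _)    -[1+ _ ] = 0Λ
  scaled s f g -[1+ _ ] _        = 0Λ

  -- S is the formal sum of the family F: for each coefficient, all but
  -- finitely many members of F contribute 0, and the others add up to that of S.
  _IsSumOf_ : Series₂ → (ℕ → ℕ → Series₂) → Set ℓ
  S IsSumOf F = ∀ i j → ∃[ n ]
    (∀ p q → n ℕ.≤ p ⊎ n ℕ.≤ q → F p q i j ≈Λ 0Λ) ×
    S i j ≈Λ ∑Λ {n} (λ p → ∑Λ {n} (λ q → F (toℕ p) (toℕ q) i j))

  -- s_{(p|q);a} / ((u - a₁) ⋯ (u - aₚ₊₁) (v - â₁) ⋯ (v - â_{q+1})), with the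
  -- Schur function computed by an N × N determinant.
  hookTerm : ℕ → Sequence → ℕ → ℕ → Series₂
  hookTerm N a p q = scaled (sₘ N (hook p q) a)
    (inverseProduct (suc p) a) (inverseProduct (suc q) (dual a))

-- Let s°(i|j) be the classical hook Schur functions; they satisfy s°(i|j+1) + s°(i+1|j) = h_{i+1} e_{j+1},
-- s°(i|0) = h_{i+1} and s°(0|j) = e_{j+1}.  Let L be the linear functional xⁱyʲ ↦ s°(i|j).  Then
--   s_{(p|q);a} = L((x - a₁) ⋯ (x - aₚ) (y - â₁) ⋯ (y - â_q)).
-- By expansion of the determinant along its first column,
--   s_{(p|q+1);a} + s_{(p+1|q);τ⁻¹a} = h_{p+1;a} s_{(0|q);τ⁻¹a},
-- and L of these products satisfies the same recursion, because the roots a₀ and - a₀ added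
-- to the x- and the y-factor contribute (x - a₀) + (y + a₀) = x + y.  Newton interpolation in x
-- and in y now gives
--   Σ s_{(p|q);a} / ((u - a₁) ⋯ (u - aₚ₊₁) (v - â₁) ⋯ (v - â_{q+1})) = Σ s°(i|j) u⁻ⁱ⁻¹ v⁻ʲ⁻¹,
-- independently of a, and multiplying by u + v leaves H(u)E(v) - 1.
module Submission where

open import Level using (Level)
open import Algebra.Bundles using (CommutativeRing)
open import Data.List.Base using (length)
open import Data.Nat.Base using (ℕ; _≤_)
open import Data.Product.Base using (_×_; ∃-syntax)
open import Defs

open import Algebra.Bundles using (RawRing; Semiring)
open import Data.Fin.Base as Fin using (Fin; toℕ)
open import Data.Integer.Base as ℤ using (ℤ; +_; -[1+_])
open import Data.List.Base as List using (List; []; _∷_; applyUpTo; replicate)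
open import Data.List.Properties using (length-applyUpTo; length-replicate)
open import Data.List.Relation.Unary.All using (All; []; _∷_; all?)
open import Data.Nat.Base as ℕ using (zero; suc; z≤n; s≤s; _∸_; _<_)
open import Data.Nat.Combinatorics using (_C_; nCn≡1; nCk+nC[k+1]≡[n+1]C[k+1]; k>n⇒nCk≡0)
open import Data.Nat.ListAction using (sum)
import Data.Nat.Properties as ℕₚ
import Data.Integer.Properties as ℤₚ
import Data.Integer.Solver
open import Data.Product.Base using (_,_)
open import Data.Sum.Base using (inj₁; inj₂)
open import Function.Base using (_∘_)
open import Relation.Binary.PropositionalEquality as ≡ using (_≡_)
open import Relation.Nullary using (Dec; yes; no; contradiction; _×-dec_)

module HookSeries {c ℓ : Level} (K : CommutativeRing c ℓ) where
  open Symmetric K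
  open Λ
  open Determinant Λ-rawRing
  open CommutativeRing K renaming (Carrier to 𝕂)
  open import Algebra.Definitions.RawMonoid +-rawMonoid using () renaming (sum to ∑; _×_ to _·_)
  open import Algebra.Definitions.RawMonoid (RawRing.+-rawMonoid Λ-rawRing)
    using () renaming (sum to ∑Λ)
  open import Algebra.Definitions.RawMonoid (RawRing.*-rawMonoid Λ-rawRing)
    using () renaming (_×_ to power)
  open import Algebra.Definitions.RawSemiring (Semiring.rawSemiring semiring) using (_^_)
  open import Algebra.Properties.CommutativeMonoid.Sum +-commutativeMonoid
    using (sum-cong-≋; sum-replicate-zero; ∑-distrib-+)
  open import Algebra.Properties.Monoid.Mult +-monoid using (×-congʳ; ×-congˡ; ×-homo-+)
  open import Algebra.Properties.Semiring.Sum semiring using (*-distribˡ-sum)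
  open import Algebra.Properties.Ring ring using (-0#≈0#; -1*x≈-x; xyx⁻¹≈y)
  open import Relation.Binary.Reasoning.Setoid setoid

  open import Algebra.Solver.Ring.NaturalCoefficients.Default commutativeSemiring
    using (solve; _:=_; _:+_; _:*_)

  -- Polynomials with prescribed roots under a linear functional.

  -- The image of (x - b₀) ⋯ (x - bₘ₋₁) under the linear functional xᵏ ↦ g k.
  newton : ℕ → (ℕ → 𝕂) → (ℕ → 𝕂) → 𝕂
  newton zero    b g = g 0
  newton (suc m) b g = newton m (b ∘ suc) (λ k → g (suc k) + - b 0 * g k)

  newton-cong : ∀ m {b b′ g g′} → (∀ i → b i ≈ b′ i) → (∀ k → g k ≈ g′ k) →
                newton m b g ≈ newton m b′ g′
  newton-cong zero    p q = q 0
  newton-cong (suc m) p q = newton-cong m (p ∘ suc) λ k →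
    +-cong (q (suc k)) (*-cong (-‿cong (p 0)) (q k))

  -- `newton` touches its argument only through combinations g + d * h, so any operator preserving
  -- these passes through it. The law has this shape in order to serve both multiplication in `Λ`
  -- and a second `newton`.
  newton-map : ∀ {x} {X : Set x} (T : (X → 𝕂) → 𝕂) →
    (∀ {g h} → (∀ x → g x ≈ h x) → T g ≈ T h) →
    (∀ g d h → T (λ x → g x + d * h x) ≈ T g + d * T h) →
    ∀ m b (g : ℕ → X → 𝕂) → T (λ x → newton m b (λ k → g k x)) ≈ newton m b (λ k → T (g k))
  newton-map T T-cong T-lin zero    b g = refl
  newton-map T T-cong T-lin (suc m) b g = trans
    (newton-map T T-cong T-lin m (b ∘ suc) (λ k x → g (suc k) x + - b 0 * g k x))
    (newton-cong m (λ _ → refl) λ k → T-lin (g (suc k)) (- b 0) (g k))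

  newton-linear : ∀ m b g d h → newton m b (λ k → g k + d * h k) ≈ newton m b g + d * newton m b h
  newton-linear zero    b g d h = refl
  newton-linear (suc m) b g d h = trans
    (newton-cong m (λ _ → refl) λ k →
      solve 6 (λ g₁ h₁ f g₀ h₀ d →
        ((g₁ :+ (d :* h₁)) :+ (f :* (g₀ :+ (d :* h₀)))) :=
        ((g₁ :+ (f :* g₀)) :+ (d :* (h₁ :+ (f :* h₀)))))
        refl (g (suc k)) (h (suc k)) (- b 0) (g k) (h k) d)
    (newton-linear m (b ∘ suc) (λ k → g (suc k) + - b 0 * g k) d (λ k → h (suc k) + - b 0 * h k))

  newton-+ : ∀ m b g h → newton m b (λ k → g k + h k) ≈ newton m b g + newton m b h
  newton-+ m b g h = begin
    newton m b (λ k → g k + h k)       ≈⟨ newton-cong m (λ _ → refl) (λ k → +-congˡ (*-identityˡ (h k))) ⟨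
    newton m b (λ k → g k + 1# * h k)  ≈⟨ newton-linear m b g 1# h ⟩
    newton m b g + 1# * newton m b h   ≈⟨ +-congˡ (*-identityˡ _) ⟩
    newton m b g + newton m b h        ∎

  newton-comm : ∀ m b n d (g : ℕ → ℕ → 𝕂) →
    newton m b (λ i → newton n d (λ j → g i j)) ≈ newton n d (λ j → newton m b (λ i → g i j))
  newton-comm m b n d g = newton-map (newton m b) (newton-cong m (λ _ → refl)) (newton-linear m b)
    n d (λ j i → g i j)

  -- Geometric series and Newton interpolation.

  ∑-zero : ∀ n {f : Fin n → 𝕂} → (∀ i → f i ≈ 0#) → ∑ f ≈ 0#
  ∑-zero n p = trans (sum-cong-≋ p) (sum-replicate-zero n)

  ∑-linear : ∀ n (f : Fin n → 𝕂) d g → ∑ (λ i → f i + d * g i) ≈ ∑ f + d * ∑ g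
  ∑-linear n f d g = trans (∑-distrib-+ f (λ i → d * g i)) (+-congˡ (sym (*-distribˡ-sum d g)))

  geometric-zero : ∀ b f → (geometric b *₁ f) 0 ≈ 0#
  geometric-zero b f = trans (+-identityʳ _) (zeroˡ _)

  -- Coefficientwise form of (t - b) · 1 / (t - b) = 1, since multiplication by t shifts the index.
  -- Poles are peeled off one at a time in this way.
  geometric-suc : ∀ b f n → (geometric b *₁ f) (suc n) ≈ f n + b * (geometric b *₁ f) n
  geometric-suc b f zero    = begin
    0# * f 1 + (1# * f 0 + 0#)       ≈⟨ +-cong (zeroˡ _) (trans (+-identityʳ _) (*-identityˡ _)) ⟩
    0# + f 0                         ≈⟨ +-comm _ _ ⟩
    f 0 + 0#                         ≈⟨ +-congˡ (trans (*-congˡ (geometric-zero b f)) (zeroʳ b)) ⟨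
    f 0 + b * (geometric b *₁ f) 0   ∎
  geometric-suc b f (suc n) = begin
    0# * f (suc (suc n)) + (1# * f (suc n) + ∑ (λ (i : Fin (suc n)) → (b * b ^ toℕ i) * f (n ∸ toℕ i)))
      ≈⟨ +-cong (zeroˡ _) (+-cong (*-identityˡ _) (sum-cong-≋ {suc n} λ i → *-assoc b (b ^ toℕ i) (f (n ∸ toℕ i)))) ⟩
    0# + (f (suc n) + ∑ (λ (i : Fin (suc n)) → b * (b ^ toℕ i * f (n ∸ toℕ i))))
      ≈⟨ trans (+-identityˡ _) (+-congˡ (sym (*-distribˡ-sum {suc n} b λ i → b ^ toℕ i * f (n ∸ toℕ i)))) ⟩
    f (suc n) + b * ∑ (λ (i : Fin (suc n)) → b ^ toℕ i * f (n ∸ toℕ i))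
      ≈⟨ +-congˡ (*-congˡ (trans (+-congʳ (zeroˡ _)) (+-identityˡ _))) ⟨
    f (suc n) + b * (geometric b *₁ f) (suc n) ∎

  -- 1 / ((t - b₀) ⋯ (t - bₙ₋₁))
  poles : ℕ → (ℕ → 𝕂) → Series₁
  poles n b = List.foldr (λ x f → geometric x *₁ f) one₁ (applyUpTo b n)

  -- Each factor 1 / (t - b) starts at t⁻¹, so a product of n of them starts at t⁻ⁿ. This is what
  -- makes the sums over p and q finite in each coefficient.
  poles-vanish : ∀ {n i} b → i < n → poles n b i ≈ 0#
  poles-vanish {suc n} {zero}  b _         = geometric-zero (b 0) (poles n (b ∘ suc))
  poles-vanish {suc n} {suc i} b (s≤s i<n) = begin
    poles (suc n) b (suc i)                       ≈⟨ geometric-suc (b 0) (poles n (b ∘ suc)) i ⟩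
    poles n (b ∘ suc) i + b 0 * poles (suc n) b i
      ≈⟨ +-cong (poles-vanish (b ∘ suc) i<n) (*-congˡ (poles-vanish b (ℕₚ.m<n⇒m<1+n i<n))) ⟩
    0# + b 0 * 0#                                 ≈⟨ trans (+-identityˡ _) (zeroʳ _) ⟩
    0#                                            ∎

  -- The coefficient of t⁻ⁱ in the first n terms of the interpolation series. Term p starts at
  -- t⁻ᵖ⁻¹, so these terms already determine all coefficients up to t⁻ⁿ.
  newtonSum : ℕ → ℕ → (ℕ → 𝕂) → (ℕ → 𝕂) → 𝕂
  newtonSum n i b g = ∑ {n} λ p → poles (suc (toℕ p)) b i * newton (toℕ p) b g

  newtonSum-zero : ∀ n b g → newtonSum n 0 b g ≈ 0#
  newtonSum-zero n b g = ∑-zero n λ p →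
    trans (*-congʳ (poles-vanish {suc (toℕ p)} b (s≤s z≤n))) (zeroˡ _)

  -- Multiply by t - b₀, the pole common to all terms: term 0 leaves g 0, and the others form the
  -- same kind of sum for the shifted nodes and the functional twisted by x - b₀.
  newtonSum-suc : ∀ n i b g → newtonSum (suc n) (suc i) b g ≈
    (one₁ i * g 0 + newtonSum n i (b ∘ suc) (λ k → g (suc k) + - b 0 * g k)) +
      b 0 * newtonSum (suc n) i b g
  newtonSum-suc n i b g = begin
    poles 1 b (suc i) * g 0 + ∑ (λ (p : Fin n) → poles (suc (suc (toℕ p))) b (suc i) * N p)
      ≈⟨ +-cong (*-congʳ (geometric-suc (b 0) one₁ i)) (trans
           (sum-cong-≋ {n} λ p → trans (*-congʳ (geometric-suc (b 0) (poles (suc (toℕ p)) (b ∘ suc)) i))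
             (solve 4 (λ x d y z → ((x :+ (d :* y)) :* z) := ((x :* z) :+ (d :* (y :* z)))) refl _ (b 0) _ (N p)))
           (∑-linear n (λ p → poles (suc (toℕ p)) (b ∘ suc) i * N p) (b 0)
             (λ p → poles (suc (suc (toℕ p))) b i * N p))) ⟩
    (one₁ i + b 0 * poles 1 b i) * g 0 + (X + b 0 * Y)
      ≈⟨ solve 6 (λ o d q g x y → (((o :+ (d :* q)) :* g) :+ (x :+ (d :* y))) :=
                   (((o :* g) :+ x) :+ (d :* ((q :* g) :+ y)))) refl
           (one₁ i) (b 0) (poles 1 b i) (g 0) X Y ⟩
    (one₁ i * g 0 + X) + b 0 * (poles 1 b i * g 0 + Y) ∎
    where
    N : Fin n → 𝕂
    N p = newton (toℕ p) (b ∘ suc) (λ k → g (suc k) + - b 0 * g k)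
    X Y : 𝕂
    X = ∑ {n} λ p → poles (suc (toℕ p)) (b ∘ suc) i * N p
    Y = ∑ {n} λ p → poles (suc (suc (toℕ p))) b i * N p

  -- Newton interpolation: Σₚ (x - b₀) ⋯ (x - bₚ₋₁) / ((t - b₀) ⋯ (t - bₚ)) = 1 / (t - x).
  newton-expansion : ∀ {n i} b g → i < n → newtonSum n (suc i) b g ≈ g i
  newton-expansion {suc n} {zero} b g _ = begin
    newtonSum (suc n) 1 b g                                  ≈⟨ newtonSum-suc n 0 b g ⟩
    (1# * g 0 + newtonSum n 0 _ _) + b 0 * newtonSum (suc n) 0 b g
      ≈⟨ +-cong (+-cong (*-identityˡ _) (newtonSum-zero n _ _)) (*-congˡ (newtonSum-zero (suc n) b g)) ⟩
    (g 0 + 0#) + b 0 * 0#                                    ≈⟨ +-cong (+-identityʳ _) (zeroʳ _) ⟩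
    g 0 + 0#                                                 ≈⟨ +-identityʳ _ ⟩
    g 0                                                      ∎
  newton-expansion {suc n} {suc i} b g (s≤s i<n) = begin
    newtonSum (suc n) (suc (suc i)) b g                      ≈⟨ newtonSum-suc n (suc i) b g ⟩
    (0# * g 0 + newtonSum n (suc i) _ _) + b 0 * newtonSum (suc n) (suc i) b g
      ≈⟨ +-cong (+-cong (zeroˡ _) (newton-expansion _ _ i<n))
           (*-congˡ (newton-expansion b g (ℕₚ.m<n⇒m<1+n i<n))) ⟩
    (0# + (g (suc i) + - b 0 * g i)) + b 0 * g i             ≈⟨ +-congʳ (+-identityˡ _) ⟩
    (g (suc i) + - b 0 * g i) + b 0 * g i                    ≈⟨ +-assoc _ _ _ ⟩
    g (suc i) + (- b 0 * g i + b 0 * g i)                    ≈⟨ +-congˡ (distribʳ _ _ _) ⟨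
    g (suc i) + (- b 0 + b 0) * g i                          ≈⟨ +-congˡ (trans (*-congʳ (-‿inverseˡ _)) (zeroˡ _)) ⟩
    g (suc i) + 0#                                           ≈⟨ +-identityʳ _ ⟩
    g (suc i)                                                ∎

  -- Sums over i + j = n.

  antidiagonal : ℕ → (ℕ → ℕ → 𝕂) → 𝕂
  antidiagonal n g = ∑ {suc n} λ i → g (toℕ i) (n ∸ toℕ i)

  antidiagonal-cong : ∀ n {g g′} → (∀ i j → g i j ≈ g′ i j) → antidiagonal n g ≈ antidiagonal n g′
  antidiagonal-cong n p = sum-cong-≋ {suc n} λ i → p (toℕ i) (n ∸ toℕ i)

  -- The sum unfolds from the end i = 0 by definition; inductions that change the second index need
  -- the other end.
  antidiagonal-last : ∀ n g →
    antidiagonal (suc n) g ≈ antidiagonal n (λ i j → g i (suc j)) + g (suc n) 0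
  antidiagonal-last zero    g = begin
    g 0 1 + (g 1 0 + 0#)  ≈⟨ +-congˡ (+-comm _ _) ⟩
    g 0 1 + (0# + g 1 0)  ≈⟨ +-assoc _ _ _ ⟨
    (g 0 1 + 0#) + g 1 0  ∎
  antidiagonal-last (suc n) g =
    trans (+-congˡ (antidiagonal-last n λ i j → g (suc i) j)) (sym (+-assoc _ _ _))

  antidiagonal-flip : ∀ n g → antidiagonal n g ≈ antidiagonal n (λ i j → g j i)
  antidiagonal-flip zero    g = refl
  antidiagonal-flip (suc n) g = begin
    g 0 (suc n) + antidiagonal n (λ i j → g (suc i) j)
      ≈⟨ +-congˡ (antidiagonal-flip n λ i j → g (suc i) j) ⟩
    g 0 (suc n) + antidiagonal n (λ i j → g (suc j) i)  ≈⟨ +-comm _ _ ⟩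
    antidiagonal n (λ i j → g (suc j) i) + g 0 (suc n)  ≈⟨ antidiagonal-last n (λ i j → g j i) ⟨
    antidiagonal (suc n) (λ i j → g j i) ∎

  antidiagonal-linear : ∀ n g d h →
    antidiagonal n (λ i j → g i j + d * h i j) ≈ antidiagonal n g + d * antidiagonal n h
  antidiagonal-linear n g d h = ∑-linear (suc n) (λ i → g (toℕ i) (n ∸ toℕ i)) d
    (λ i → h (toℕ i) (n ∸ toℕ i))

  -- Elementary symmetric polynomials as coefficients of a product.

  private
    product : List 𝕂 → 𝕂
    product = List.foldr _*_ 1#

    add : List 𝕂 → 𝕂
    add = List.foldr _+_ 0#

    add-++ : ∀ {A : Set c} (f : A → 𝕂) xs ys →
      add (List.map f (xs List.++ ys)) ≈ add (List.map f xs) + add (List.map f ys)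
    add-++ f []       ys = sym (+-identityˡ _)
    add-++ f (x ∷ xs) ys = trans (+-congˡ (add-++ f xs ys)) (sym (+-assoc _ _ _))

    add-product-∷ : ∀ x xss →
      add (List.map product (List.map (x ∷_) xss)) ≈ x * add (List.map product xss)
    add-product-∷ x []         = sym (zeroʳ x)
    add-product-∷ x (xs ∷ xss) = trans (+-congˡ (add-product-∷ x xss)) (sym (distribˡ _ _ _))

  elem-zero : ∀ xs → elem 0 xs ≈ 1#
  elem-zero xs = +-identityʳ 1#

  elem-suc-∷ : ∀ k x xs → elem (suc k) (x ∷ xs) ≈ x * elem k xs + elem (suc k) xs
  elem-suc-∷ k x xs = trans (add-++ product (List.map (x ∷_) (choose k xs)) (choose (suc k) xs))
    (+-congʳ (add-product-∷ x (choose k xs)))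

  elem-vanish : ∀ {k} xs → length xs < k → elem k xs ≈ 0#
  elem-vanish {suc k} []       _         = refl
  elem-vanish {suc k} (x ∷ xs) (s≤s lt) = begin
    elem (suc k) (x ∷ xs)              ≈⟨ elem-suc-∷ k x xs ⟩
    x * elem k xs + elem (suc k) xs
      ≈⟨ +-cong (*-congˡ (elem-vanish xs lt)) (elem-vanish xs (ℕₚ.m<n⇒m<1+n lt)) ⟩
    x * 0# + 0#                        ≈⟨ trans (+-identityʳ _) (zeroʳ x) ⟩
    0#                                 ∎

  -- For k ≤ m, the coefficient of xᵐ⁻ᵏ in (x - b₀) ⋯ (x - bₘ₋₁).
  signedElem : ℕ → ℕ → (ℕ → 𝕂) → 𝕂
  signedElem k m b = (- 1#) ^ k * elem k (applyUpTo b m)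

  signedElem-zero : ∀ m b → signedElem 0 m b ≈ 1#
  signedElem-zero m b = trans (*-identityˡ _) (elem-zero (applyUpTo b m))

  signedElem-suc : ∀ k m b →
    signedElem (suc k) (suc m) b ≈ signedElem (suc k) m (b ∘ suc) + - b 0 * signedElem k m (b ∘ suc)
  signedElem-suc k m b = begin
    (- 1# * s) * elem (suc k) (applyUpTo b (suc m))  ≈⟨ *-congˡ (elem-suc-∷ k (b 0) _) ⟩
    (- 1# * s) * (b 0 * x + y)
      ≈⟨ solve 5 (λ n s b x y → (n :* s) :* (b :* x :+ y) := (n :* s) :* y :+ (n :* b) :* (s :* x))
           refl (- 1#) s (b 0) x y ⟩
    (- 1# * s) * y + (- 1# * b 0) * (s * x)          ≈⟨ +-congˡ (*-congʳ (-1*x≈-x (b 0))) ⟩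
    (- 1# * s) * y + - b 0 * (s * x)                 ∎
    where
    s x y : 𝕂
    s = (- 1#) ^ k
    x = elem k (applyUpTo (b ∘ suc) m)
    y = elem (suc k) (applyUpTo (b ∘ suc) m)

  -- Vieta's formula: the left side evaluates the functional on the product expanded in powers of x.
  -- The induction splits off the root b₀.
  signedElem-newton : ∀ m b g → antidiagonal m (λ i k → signedElem k m b * g i) ≈ newton m b g
  signedElem-newton zero    b g = begin
    signedElem 0 0 b * g 0 + 0#  ≈⟨ +-identityʳ _ ⟩
    signedElem 0 0 b * g 0       ≈⟨ *-congʳ (signedElem-zero 0 b) ⟩
    1# * g 0                     ≈⟨ *-identityˡ _ ⟩
    g 0                          ∎
  signedElem-newton (suc m) b g = begin
    antidiagonal (suc m) (λ i k → signedElem k (suc m) b * g i)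
      ≈⟨ antidiagonal-last m (λ i k → signedElem k (suc m) b * g i) ⟩
    antidiagonal m (λ i k → signedElem (suc k) (suc m) b * g i) + signedElem 0 (suc m) b * g (suc m)
      ≈⟨ +-cong (antidiagonal-cong m λ i k → trans (*-congʳ (signedElem-suc k m b))
           (solve 4 (λ x d y z → (x :+ d :* y) :* z := x :* z :+ d :* (y :* z)) refl _ (- b 0) _ (g i)))
           (*-congʳ (trans (signedElem-zero (suc m) b) (sym (signedElem-zero m b′)))) ⟩
    antidiagonal m (λ i k → signedElem (suc k) m b′ * g i + - b 0 * (signedElem k m b′ * g i)) +
      signedElem 0 m b′ * g (suc m)
      ≈⟨ +-congʳ (antidiagonal-linear m (λ i k → signedElem (suc k) m b′ * g i) (- b 0)
           (λ i k → signedElem k m b′ * g i)) ⟩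
    (X + - b 0 * Y) + Z
      ≈⟨ solve 4 (λ x d y z → (x :+ d :* y) :+ z := (x :+ z) :+ d :* y) refl X (- b 0) Y Z ⟩
    (X + Z) + - b 0 * Y
      ≈⟨ +-congʳ (antidiagonal-last m (λ i k → signedElem k m b′ * g i)) ⟨
    antidiagonal (suc m) (λ i k → signedElem k m b′ * g i) + - b 0 * Y
      -- The summand i = 0 contains the elementary polynomial of degree m + 1 in m variables, which
      -- is 0; the other summands belong to `g ∘ suc`.
      ≈⟨ +-cong (trans (+-congʳ (trans (*-congʳ vanish) (zeroˡ _))) (+-identityˡ _)) refl ⟩
    antidiagonal m (λ i k → signedElem k m b′ * g (suc i)) + - b 0 * Y
      ≈⟨ +-cong (signedElem-newton m b′ (g ∘ suc)) (*-congˡ (signedElem-newton m b′ g)) ⟩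
    newton m b′ (g ∘ suc) + - b 0 * newton m b′ g
      ≈⟨ newton-linear m b′ (g ∘ suc) (- b 0) g ⟨
    newton (suc m) b g ∎
    where
    b′ : ℕ → 𝕂
    b′ = b ∘ suc
    X Y Z : 𝕂
    X = antidiagonal m λ i k → signedElem (suc k) m b′ * g i
    Y = antidiagonal m λ i k → signedElem k m b′ * g i
    Z = signedElem 0 m b′ * g (suc m)
    vanish : signedElem (suc m) m b′ ≈ 0#
    vanish = trans (*-congˡ (elem-vanish (applyUpTo b′ m)
      (≡.subst (_< suc m) (≡.sym (length-applyUpTo b′ m)) ℕₚ.≤-refl))) (zeroʳ _)

  -- Coefficients of the multiparameter complete functions.

  coeff-∑ : ∀ n (F : Fin n → Λ) xs → coeff (∑Λ F) xs ≈ ∑ (λ i → coeff (F i) xs)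
  coeff-∑ zero    F xs = refl
  coeff-∑ (suc n) F xs = +-congˡ (coeff-∑ n (F ∘ Fin.suc) xs)

  -- a₁, a₂, …, indexed from 0
  tail₁ : Sequence → ℕ → 𝕂
  tail₁ a i = a (+ suc i)

  -- The defining sum is x (x - a₁) ⋯ (x - aₘ), expanded, with xⁱ replaced by hᵢ. The extra factor x
  -- turns k into `suc k`.
  coeff-hₘ : ∀ m a xs → coeff (hₘ (+ suc m) a) xs ≈ newton m (tail₁ a) (λ k → coeff (hΛ (suc k)) xs)
  coeff-hₘ m a xs = trans (coeff-∑ (suc m)
    (λ i → ((- 1#) ^ (m ∸ toℕ i) * elem (m ∸ toℕ i) (initial m a)) • hΛ (suc (toℕ i))) xs)
    (signedElem-newton m (tail₁ a) λ k → coeff (hΛ (suc k)) xs)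

  -- Commutativity, unit and bilinearity of the product in `Λ`.

  conv-congˡ : ∀ f {g g′} → (∀ xs → g xs ≈ g′ xs) → ∀ xs → conv f g xs ≈ conv f g′ xs
  conv-congˡ f p = conv-cong {f} (λ _ → refl) p

  conv-comm : ∀ f g xs → conv f g xs ≈ conv g f xs
  conv-comm f g []       = *-comm _ _
  conv-comm f g (x ∷ xs) = trans
    (antidiagonal-flip x λ i j → conv (λ ys → f (i ∷ ys)) (λ zs → g (j ∷ zs)) xs)
    (antidiagonal-cong x λ i j → conv-comm (λ ys → f (j ∷ ys)) (λ zs → g (i ∷ zs)) xs)

  conv-linearˡ : ∀ f f′ d g xs → conv (λ ys → f ys + d * f′ ys) g xs ≈ conv f g xs + d * conv f′ g xs
  conv-linearˡ f f′ d g []       =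
    solve 4 (λ x y d z → (x :+ d :* y) :* z := x :* z :+ d :* (y :* z)) refl _ _ d _
  conv-linearˡ f f′ d g (x ∷ xs) = trans
    (antidiagonal-cong x λ i j → conv-linearˡ (λ ys → f (i ∷ ys)) (λ ys → f′ (i ∷ ys)) d (λ zs → g (j ∷ zs)) xs)
    (antidiagonal-linear x (λ i j → conv (λ ys → f (i ∷ ys)) (λ zs → g (j ∷ zs)) xs) d
      (λ i j → conv (λ ys → f′ (i ∷ ys)) (λ zs → g (j ∷ zs)) xs))

  conv-zeroˡ : ∀ f g → (∀ xs → f xs ≈ 0#) → ∀ xs → conv f g xs ≈ 0#
  conv-zeroˡ f g p []       = trans (*-congʳ (p [])) (zeroˡ _)
  conv-zeroˡ f g p (x ∷ xs) = ∑-zero (suc x) λ i →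
    conv-zeroˡ (λ ys → f (toℕ i ∷ ys)) (λ zs → g (x ∸ toℕ i ∷ zs)) (λ ys → p (toℕ i ∷ ys)) xs

  -- `1Λ` vanishes on monomials with a positive exponent, so only the splitting that gives all of x
  -- to the second factor survives.
  conv-identityˡ : ∀ g xs → conv (coeff 1Λ) g xs ≈ g xs
  conv-identityˡ g []       = *-identityˡ _
  conv-identityˡ g (x ∷ xs) = trans
    (+-cong (conv-identityˡ (λ zs → g (x ∷ zs)) xs)
      (∑-zero x λ i → conv-zeroˡ _ (λ zs → g (x ∸ suc (toℕ i) ∷ zs)) (λ _ → refl) xs))
    (+-identityʳ _)

  conv-negˡ : ∀ f g xs → conv (λ ys → - f ys) g xs ≈ - conv f g xs
  conv-negˡ f g xs = begin
    conv (λ ys → - f ys) g xs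
      ≈⟨ conv-cong {g = g} (λ ys → trans (+-identityˡ _) (-1*x≈-x _)) (λ _ → refl) xs ⟨
    conv (λ ys → 0# + - 1# * f ys) g xs        ≈⟨ conv-linearˡ (λ _ → 0#) f (- 1#) g xs ⟩
    conv (λ _ → 0#) g xs + - 1# * conv f g xs  ≈⟨ +-cong (conv-zeroˡ _ g (λ _ → refl) xs) (-1*x≈-x _) ⟩
    0# + - conv f g xs                         ≈⟨ +-identityˡ _ ⟩
    - conv f g xs                              ∎

  conv-newtonˡ : ∀ m b (f : ℕ → List ℕ → 𝕂) g xs →
    conv (λ ys → newton m b (λ k → f k ys)) g xs ≈ newton m b (λ k → conv (f k) g xs)
  conv-newtonˡ m b f g xs = newton-map (λ φ → conv φ g xs)
    (λ p → conv-cong {g = g} p (λ _ → refl) xs) (λ φ d ψ → conv-linearˡ φ ψ d g xs) m b f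

  conv-newtonʳ : ∀ m b f (g : ℕ → List ℕ → 𝕂) xs →
    conv f (λ ys → newton m b (λ k → g k ys)) xs ≈ newton m b (λ k → conv f (g k) xs)
  conv-newtonʳ m b f g xs = begin
    conv f (λ ys → newton m b (λ k → g k ys)) xs  ≈⟨ conv-comm f _ xs ⟩
    conv (λ ys → newton m b (λ k → g k ys)) f xs  ≈⟨ conv-newtonˡ m b g f xs ⟩
    newton m b (λ k → conv (g k) f xs)            ≈⟨ newton-cong m (λ _ → refl) (λ k → conv-comm (g k) f xs) ⟩
    newton m b (λ k → conv f (g k) xs)            ∎

  -- Monomial coefficients of the products of eⱼ and hᵢ.

  -- The number of variables occurring in the monomial. A factor from eⱼ selects j of them, which is
  -- why binomial coefficients in this number appear.
  support : List ℕ → ℕ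
  support []           = 0
  support (zero  ∷ xs) = support xs
  support (suc x ∷ xs) = suc (support xs)

  support≤sum : ∀ xs → support xs ≤ sum xs
  support≤sum []           = z≤n
  support≤sum (zero  ∷ xs) = support≤sum xs
  support≤sum (suc x ∷ xs) = s≤s (ℕₚ.≤-trans (support≤sum xs) (ℕₚ.m≤n+m _ x))

  support≡0⇒sum≡0 : ∀ xs → support xs ≡ 0 → sum xs ≡ 0
  support≡0⇒sum≡0 []          _  = ≡.refl
  support≡0⇒sum≡0 (zero ∷ xs) eq = support≡0⇒sum≡0 xs eq

  squareFree⇒support≡sum : ∀ {xs} → All (_≤ 1) xs → support xs ≡ sum xs
  squareFree⇒support≡sum []                   = ≡.refl
  squareFree⇒support≡sum {zero ∷ _}     (_ ∷ p)      = squareFree⇒support≡sum p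
  squareFree⇒support≡sum {suc zero ∷ _} (_ ∷ p)      = ≡.cong suc (squareFree⇒support≡sum p)
  squareFree⇒support≡sum {suc (suc _) ∷ _} (s≤s () ∷ _)

  -- Each occurring variable contributes at least 1 to the degree, so equality leaves no room for an
  -- exponent above 1.
  support≡sum⇒squareFree : ∀ xs → support xs ≡ sum xs → All (_≤ 1) xs
  support≡sum⇒squareFree []                 _  = []
  support≡sum⇒squareFree (zero ∷ xs)        eq = z≤n ∷ support≡sum⇒squareFree xs eq
  support≡sum⇒squareFree (suc zero ∷ xs)    eq =
    s≤s z≤n ∷ support≡sum⇒squareFree xs (ℕₚ.suc-injective eq)
  support≡sum⇒squareFree (suc (suc x) ∷ xs) eq = contradiction (ℕₚ.suc-injective eq)
    (ℕₚ.<⇒≢ (s≤s (ℕₚ.≤-trans (support≤sum xs) (ℕₚ.m≤n+m _ x))))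

  private
    e? : ∀ k xs → Dec (sum xs ≡ k × All (_≤ 1) xs)
    e? k xs = (sum xs ℕₚ.≟ k) ×-dec all? (ℕₚ._≤? 1) xs

    coeff-e-0 : ∀ k xs → coeff (eΛ k) (0 ∷ xs) ≈ coeff (eΛ k) xs
    coeff-e-0 k xs = indicator-cong (e? k (0 ∷ xs)) (e? k xs)
      (λ { (eq , _ ∷ p) → eq , p }) (λ (eq , p) → eq , z≤n ∷ p)

    coeff-e-1 : ∀ k xs → coeff (eΛ (suc k)) (1 ∷ xs) ≈ coeff (eΛ k) xs
    coeff-e-1 k xs = indicator-cong (e? (suc k) (1 ∷ xs)) (e? k xs)
      (λ { (eq , _ ∷ p) → ℕₚ.suc-injective eq , p }) (λ (eq , p) → ≡.cong suc eq , s≤s z≤n ∷ p)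

    coeff-e₀-suc : ∀ x xs → coeff (eΛ 0) (suc x ∷ xs) ≈ 0#
    coeff-e₀-suc x xs = indicator-no (e? 0 (suc x ∷ xs)) λ ()

    coeff-e-2+ : ∀ k x xs → coeff (eΛ k) (suc (suc x) ∷ xs) ≈ 0#
    coeff-e-2+ k x xs = indicator-no (e? k (suc (suc x) ∷ xs)) λ { (_ , s≤s () ∷ _) }

  [_≡_] : ℕ → ℕ → 𝕂
  [ m ≡ n ] = indicator (m ℕₚ.≟ n)

  []-cong : ∀ {m m′ n n′} → m ≡ m′ → n ≡ n′ → [ m ≡ n ] ≈ [ m′ ≡ n′ ]
  []-cong p q = reflexive (≡.cong₂ [_≡_] p q)

  -- The offset d absorbs the exponents already removed from the monomial.
  conv-e-h : ∀ d i j xs → conv (coeff (eΛ j)) (λ ys → [ d ℕ.+ sum ys ≡ i ]) xs ≈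
                          (support xs C j) · [ d ℕ.+ sum xs ≡ i ℕ.+ j ]
  conv-e-h d i zero    [] = begin
    1# * [ d ℕ.+ 0 ≡ i ]         ≈⟨ *-identityˡ _ ⟩
    [ d ℕ.+ 0 ≡ i ]              ≈⟨ []-cong {d ℕ.+ 0} ≡.refl (ℕₚ.+-identityʳ i) ⟨
    [ d ℕ.+ 0 ≡ i ℕ.+ 0 ]        ≈⟨ +-identityʳ _ ⟨
    1 · [ d ℕ.+ 0 ≡ i ℕ.+ 0 ]    ∎
  conv-e-h d i (suc j) [] = zeroˡ _
  conv-e-h d i j (zero ∷ xs) = trans (+-identityʳ _) (trans
    (conv-cong {g = λ ys → [ d ℕ.+ sum ys ≡ i ]} (coeff-e-0 j) (λ _ → refl) xs) (conv-e-h d i j xs))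
  conv-e-h d i j (suc x ∷ xs) = begin
    -- The exponent given to eⱼ is 0, 1 or at least 2. The last case contributes nothing, and the
    -- other two supply the two terms of Pascal's rule.
    t₀ + (t₁ + ∑ t₂)
      ≈⟨ +-cong t₀≈ (trans (+-congˡ (∑-zero x λ k → conv-zeroˡ _
           (λ ys → [ d ℕ.+ (x ∸ suc (toℕ k) ℕ.+ sum ys) ≡ i ]) (coeff-e-2+ j (toℕ k)) xs)) (+-identityʳ _)) ⟩
    (m C j) · [ d ℕ.+ (suc x ℕ.+ sum xs) ≡ i ℕ.+ j ] + t₁
      ≈⟨ t₁≈ j ⟩
    (suc m C j) · [ d ℕ.+ (suc x ℕ.+ sum xs) ≡ i ℕ.+ j ] ∎
    where
    m : ℕ
    m = support xs
    t₀ t₁ : 𝕂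
    t₀ = conv (λ ys → coeff (eΛ j) (0 ∷ ys)) (λ ys → [ d ℕ.+ (suc x ℕ.+ sum ys) ≡ i ]) xs
    t₁ = conv (λ ys → coeff (eΛ j) (1 ∷ ys)) (λ ys → [ d ℕ.+ (x ℕ.+ sum ys) ≡ i ]) xs
    t₂ : Fin x → 𝕂
    t₂ k = conv (λ ys → coeff (eΛ j) (suc (suc (toℕ k)) ∷ ys))
                (λ ys → [ d ℕ.+ (x ∸ suc (toℕ k) ℕ.+ sum ys) ≡ i ]) xs
    t₀≈ : t₀ ≈ (m C j) · [ d ℕ.+ (suc x ℕ.+ sum xs) ≡ i ℕ.+ j ]
    t₀≈ = begin
      t₀  ≈⟨ conv-cong (coeff-e-0 j) (λ ys → []-cong (≡.sym (ℕₚ.+-assoc d (suc x) (sum ys))) ≡.refl) xs ⟩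
      conv (coeff (eΛ j)) (λ ys → [ d ℕ.+ suc x ℕ.+ sum ys ≡ i ]) xs  ≈⟨ conv-e-h (d ℕ.+ suc x) i j xs ⟩
      (m C j) · [ d ℕ.+ suc x ℕ.+ sum xs ≡ i ℕ.+ j ]
        ≈⟨ ×-congʳ (m C j) ([]-cong (ℕₚ.+-assoc d (suc x) (sum xs)) ≡.refl) ⟩
      (m C j) · [ d ℕ.+ (suc x ℕ.+ sum xs) ≡ i ℕ.+ j ] ∎
    t₁≈ : ∀ j → let X = [ d ℕ.+ (suc x ℕ.+ sum xs) ≡ i ℕ.+ j ] in
      (m C j) · X + conv (λ ys → coeff (eΛ j) (1 ∷ ys)) (λ ys → [ d ℕ.+ (x ℕ.+ sum ys) ≡ i ]) xs ≈
      (suc m C j) · X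
    t₁≈ zero    = trans
      (+-congˡ (conv-zeroˡ _ (λ ys → [ d ℕ.+ (x ℕ.+ sum ys) ≡ i ]) (coeff-e₀-suc 0) xs)) (+-identityʳ _)
    t₁≈ (suc j) = begin
      (m C suc j) · X + conv (λ ys → coeff (eΛ (suc j)) (1 ∷ ys)) (λ ys → [ d ℕ.+ (x ℕ.+ sum ys) ≡ i ]) xs
        ≈⟨ +-congˡ (conv-cong (coeff-e-1 j) (λ ys → []-cong (≡.sym (ℕₚ.+-assoc d x (sum ys))) ≡.refl) xs) ⟩
      (m C suc j) · X + conv (coeff (eΛ j)) (λ ys → [ d ℕ.+ x ℕ.+ sum ys ≡ i ]) xs
        ≈⟨ +-congˡ (conv-e-h (d ℕ.+ x) i j xs) ⟩
      (m C suc j) · X + (m C j) · [ suc (d ℕ.+ x ℕ.+ sum xs) ≡ suc (i ℕ.+ j) ]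
        ≈⟨ +-congˡ (×-congʳ (m C j) ([]-cong
             (≡.trans (≡.cong suc (ℕₚ.+-assoc d x (sum xs))) (≡.sym (ℕₚ.+-suc d (x ℕ.+ sum xs))))
             (≡.sym (ℕₚ.+-suc i j)))) ⟩
      (m C suc j) · X + (m C j) · X  ≈⟨ +-comm _ _ ⟩
      (m C j) · X + (m C suc j) · X  ≈⟨ ×-homo-+ X (m C j) (m C suc j) ⟨
      (m C j ℕ.+ m C suc j) · X      ≈⟨ ×-congˡ (nCk+nC[k+1]≡[n+1]C[k+1] m j) ⟩
      (suc m C suc j) · X            ∎
      where
      X : 𝕂
      X = [ d ℕ.+ (suc x ℕ.+ sum xs) ≡ i ℕ.+ suc j ]

  -- Classical Schur functions of hooks.

  ×-zero : ∀ n → n · 0# ≈ 0#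
  ×-zero zero    = refl
  ×-zero (suc n) = trans (+-identityˡ _) (×-zero n)

  -- The classical Schur function of the hook (i | j).
  hookΛ : ℕ → ℕ → Λ
  hookΛ i zero    = hΛ (suc i)
  hookΛ i (suc j) = (hΛ (suc i) *Λ eΛ (suc j)) +Λ (-Λ hookΛ (suc i) j)

  -- C(m - 1, j) tableaux: the smallest of the m distinct entries sits in the corner, and the column
  -- consists of j of the others.
  coeff-hookΛ : ∀ i j xs →
    coeff (hookΛ i j) xs ≈ (ℕ.pred (support xs) C j) · [ sum xs ≡ suc (i ℕ.+ j) ]
  coeff-hookΛ i zero    xs =
    trans ([]-cong {sum xs} ≡.refl (≡.cong suc (≡.sym (ℕₚ.+-identityʳ i)))) (sym (+-identityʳ _))
  coeff-hookΛ i (suc j) xs = begin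
    conv (coeff (hΛ (suc i))) (coeff (eΛ (suc j))) xs + - coeff (hookΛ (suc i) j) xs
      ≈⟨ +-cong (trans (conv-comm (coeff (hΛ (suc i))) (coeff (eΛ (suc j))) xs) (conv-e-h 0 (suc i) (suc j) xs))
           (-‿cong (trans (coeff-hookΛ (suc i) j xs)
             (×-congʳ (ℕ.pred (support xs) C j) ([]-cong {sum xs} ≡.refl (≡.cong suc (≡.sym (ℕₚ.+-suc i j))))))) ⟩
    (support xs C suc j) · X + - ((ℕ.pred (support xs) C j) · X)  ≈⟨ pascal (support xs) ≡.refl ⟩
    (ℕ.pred (support xs) C suc j) · X                            ∎
    where
    X : 𝕂
    X = [ sum xs ≡ suc (i ℕ.+ suc j) ]
    pascal : ∀ m → support xs ≡ m →
      (m C suc j) · X + - ((ℕ.pred m C j) · X) ≈ (ℕ.pred m C suc j) · X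
    -- Here the predecessor of m is again 0, so Pascal's rule does not apply. Instead `X` is 0,
    -- because the monomial has degree 0 and `X` asks for a positive degree.
    pascal zero    eq = trans (+-congˡ (trans (-‿cong (trans (×-congʳ (0 C j) X≈0) (×-zero (0 C j)))) -0#≈0#))
      (+-identityʳ _)
      where
      X≈0 : X ≈ 0#
      X≈0 = indicator-no (sum xs ℕₚ.≟ suc (i ℕ.+ suc j)) λ p →
        contradiction (≡.trans (≡.sym (support≡0⇒sum≡0 xs eq)) p) λ ()
    pascal (suc m) eq = begin
      (suc m C suc j) · X + - ((m C j) · X)
        ≈⟨ +-congʳ (×-congˡ (nCk+nC[k+1]≡[n+1]C[k+1] m j)) ⟨
      (m C j ℕ.+ m C suc j) · X + - ((m C j) · X)
        ≈⟨ +-congʳ (×-homo-+ X (m C j) (m C suc j)) ⟩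
      ((m C j) · X + (m C suc j) · X) + - ((m C j) · X)  ≈⟨ xyx⁻¹≈y _ _ ⟩
      (m C suc j) · X                                    ∎

  -- In degree j + 1 at most m = j + 1 variables occur, so C(m - 1, j) is 1 when the monomial is
  -- square-free and 0 otherwise.
  hookΛ-column : ∀ j → hookΛ 0 j ≈Λ eΛ (suc j)
  hookΛ-column j xs = trans (coeff-hookΛ 0 j xs)
    (count (support xs) ≡.refl (sum xs ℕₚ.≟ suc j) (all? (ℕₚ._≤? 1) xs))
    where
    count : ∀ m → support xs ≡ m → (d : Dec (sum xs ≡ suc j)) (e : Dec (All (_≤ 1) xs)) →
      (ℕ.pred m C j) · indicator d ≈ indicator (d ×-dec e)
    count m       _  (no  _)  _        = ×-zero (ℕ.pred m C j)
    count zero    eq (yes p) _         =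
      contradiction (≡.trans (≡.sym (support≡0⇒sum≡0 xs eq)) p) λ ()
    count (suc m) eq (yes p) (yes sf)  = trans (×-congˡ (≡.trans (≡.cong (_C j) m≡j) (nCn≡1 j))) (+-identityʳ _)
      where
      m≡j : m ≡ j
      m≡j = ℕₚ.suc-injective (≡.trans (≡.sym eq) (≡.trans (squareFree⇒support≡sum sf) p))
    count (suc m) eq (yes p) (no ¬sf)  = ×-congˡ (k>n⇒nCk≡0 {m} {j} (ℕₚ.≤-pred
      (≡.subst₂ _<_ eq p (ℕₚ.≤∧≢⇒< (support≤sum xs) (¬sf ∘ support≡sum⇒squareFree xs)))))

  -- Determinants with few nonzero entries in the first column.

  infixr 8 _^Λ_
  _^Λ_ : Λ → ℕ → Λ
  f ^Λ n = power n f

  minor : ∀ {n} → (Fin (suc n) → Fin (suc n) → Λ) → Fin (suc n) → Fin n → Fin n → Λ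
  minor M i k l = M (Fin.punchIn i k) (Fin.suc l)

  detTerm : ∀ {n} → (Fin (suc n) → Fin (suc n) → Λ) → Fin (suc n) → Λ
  detTerm {n} M i = ((-Λ 1Λ) ^Λ toℕ i) *Λ (M i Fin.zero *Λ det n (minor M i))

  detTerm-zero : ∀ {n} M (i : Fin (suc n)) → M i Fin.zero ≈Λ 0Λ → detTerm M i ≈Λ 0Λ
  detTerm-zero {n} M i p xs = trans
    (conv-comm (coeff ((-Λ 1Λ) ^Λ toℕ i)) (coeff (M i Fin.zero *Λ det n (minor M i))) xs)
    (conv-zeroˡ _ (coeff ((-Λ 1Λ) ^Λ toℕ i)) (conv-zeroˡ _ (coeff (det n (minor M i))) p) xs)

  det-cong : ∀ n {M M′} → (∀ i j → M i j ≈Λ M′ i j) → det n M ≈Λ det n M′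
  det-cong zero    p xs = refl
  det-cong (suc n) {M} {M′} p xs = trans (coeff-∑ (suc n) (detTerm M) xs) (trans
    (sum-cong-≋ {suc n} λ i → conv-congˡ (coeff ((-Λ 1Λ) ^Λ toℕ i))
      (conv-cong (p i Fin.zero)
        (det-cong n {minor M i} {minor M′ i} λ k l → p (Fin.punchIn i k) (Fin.suc l))) xs)
    (sym (coeff-∑ (suc n) (detTerm M′) xs)))

  det-column : ∀ n M → (∀ i → M (Fin.suc i) Fin.zero ≈Λ 0Λ) →
    det (suc n) M ≈Λ M Fin.zero Fin.zero *Λ det n (minor M Fin.zero)
  det-column n M p xs = trans
    (+-cong (conv-identityˡ _ xs) (trans (coeff-∑ n (detTerm M ∘ Fin.suc) xs)
      (∑-zero n λ i → detTerm-zero M (Fin.suc i) (p i) xs)))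
    (+-identityʳ _)

  -- Only the first two rows contribute to the expansion, the second one with entry 1 and sign -1.
  det-hessenberg : ∀ n M → M (Fin.suc Fin.zero) Fin.zero ≈Λ 1Λ →
    (∀ i → M (Fin.suc (Fin.suc i)) Fin.zero ≈Λ 0Λ) →
    det (suc (suc n)) M ≈Λ
      (M Fin.zero Fin.zero *Λ det (suc n) (minor M Fin.zero)) +Λ
      (-Λ det (suc n) (minor M (Fin.suc Fin.zero)))
  det-hessenberg n M q p xs = +-cong (conv-identityˡ _ xs) (begin
    coeff (detTerm M (Fin.suc Fin.zero)) xs + coeff (∑Λ {n} (λ i → detTerm M (Fin.suc (Fin.suc i)))) xs
      ≈⟨ +-cong
           (conv-cong sign (λ ys → trans (conv-cong {g = coeff D} q (λ _ → refl) ys) (conv-identityˡ _ ys)) xs)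
           (trans (coeff-∑ n (λ i → detTerm M (Fin.suc (Fin.suc i))) xs)
             (∑-zero n λ i → detTerm-zero M (Fin.suc (Fin.suc i)) (p i) xs)) ⟩
    conv (λ ys → - coeff 1Λ ys) (coeff D) xs + 0#  ≈⟨ +-identityʳ _ ⟩
    conv (λ ys → - coeff 1Λ ys) (coeff D) xs       ≈⟨ conv-negˡ (coeff 1Λ) (coeff D) xs ⟩
    - conv (coeff 1Λ) (coeff D) xs                 ≈⟨ -‿cong (conv-identityˡ (coeff D) xs) ⟩
    - coeff D xs                                   ∎)
    where
    D : Λ
    D = det (suc n) (minor M (Fin.suc Fin.zero))
    sign : ∀ ys → conv (λ ys → - coeff 1Λ ys) (coeff 1Λ) ys ≈ - coeff 1Λ ys
    sign ys = trans (conv-comm (λ ys → - coeff 1Λ ys) (coeff 1Λ) ys) (conv-identityˡ _ ys)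

  abstract
    -- An opaque copy of `det`, so that determinants with concrete entries are not unfolded; only
    -- the rules below are available for it.
    detΛ : ∀ n → (Fin n → Fin n → Λ) → Λ
    detΛ = det

    det≈detΛ : ∀ n M → det n M ≈Λ detΛ n M
    det≈detΛ n M xs = refl

    detΛ-cong : ∀ n {M M′} → (∀ i j → M i j ≈Λ M′ i j) → detΛ n M ≈Λ detΛ n M′
    detΛ-cong = det-cong

    detΛ-zero : ∀ M → detΛ 0 M ≈Λ 1Λ
    detΛ-zero M xs = refl

    detΛ-column : ∀ n M → (∀ i → M (Fin.suc i) Fin.zero ≈Λ 0Λ) →
      detΛ (suc n) M ≈Λ M Fin.zero Fin.zero *Λ detΛ n (minor M Fin.zero)
    detΛ-column = det-column

    detΛ-hessenberg : ∀ n M → M (Fin.suc Fin.zero) Fin.zero ≈Λ 1Λ →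
      (∀ i → M (Fin.suc (Fin.suc i)) Fin.zero ≈Λ 0Λ) →
      detΛ (suc (suc n)) M ≈Λ
        (M Fin.zero Fin.zero *Λ detΛ (suc n) (minor M Fin.zero)) +Λ
        (-Λ detΛ (suc n) (minor M (Fin.suc Fin.zero)))
    detΛ-hessenberg = det-hessenberg

  -- Multiparameter Schur functions of hooks.

  hₘ-cong : ∀ {k k′ a a′} → k ≡ k′ → (∀ i → a i ≡ a′ i) → hₘ k a ≈Λ hₘ k′ a′
  hₘ-cong {+ zero}    ≡.refl p xs = refl
  hₘ-cong { -[1+ _ ]} ≡.refl p xs = refl
  hₘ-cong {+ suc m} {a = a} {a′} ≡.refl p xs = trans (coeff-hₘ m a xs) (trans
    (newton-cong m (λ i → reflexive (p (+ suc i))) (λ _ → refl)) (sym (coeff-hₘ m a′ xs)))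

  τ⁻¹ : Sequence → Sequence
  τ⁻¹ = τ -[1+ 0 ]

  private
    open Data.Integer.Solver.+-*-Solver using () renaming
      (solve to solveℤ; _:=_ to _:=ℤ_; _:+_ to _:+ℤ_; _:-_ to _:-ℤ_; :-_ to :-ℤ_; con to conℤ)

    τ-τ⁻¹ : ∀ a j i → τ (+ 1 ℤ.- + suc (suc j)) a i ≡ τ (+ 1 ℤ.- + suc j) (τ⁻¹ a) i
    τ-τ⁻¹ a j i = ≡.cong a (solveℤ 2 (λ i j →
      i :+ℤ (conℤ (+ 1) :-ℤ (conℤ (+ 2) :+ℤ j)) :=ℤ
      (i :+ℤ (conℤ (+ 1) :-ℤ (conℤ (+ 1) :+ℤ j))) :+ℤ conℤ -[1+ 0 ]) ≡.refl i (+ j))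

    -- Shifting a one way shifts its dual the other way, so `τ⁻¹` discards the first dual parameter
    -- - a₀. This links the y-roots in the induction on q.
    dual-τ⁻¹ : ∀ a i → tail₁ (dual a) (suc i) ≡ tail₁ (dual (τ⁻¹ a)) i
    dual-τ⁻¹ a i = ≡.cong (λ k → - a k) (solveℤ 1 (λ i →
      conℤ (+ 1) :-ℤ (conℤ (+ 2) :+ℤ i) :=ℤ (conℤ (+ 1) :-ℤ (conℤ (+ 1) :+ℤ i)) :+ℤ conℤ -[1+ 0 ])
      ≡.refl (+ i))

    index-shift : ∀ x i j → + x ℤ.- + suc (suc i) ℤ.+ + suc (suc j) ≡ + x ℤ.- + suc i ℤ.+ + suc j
    index-shift x i j = solveℤ 3 (λ x i j →
      (x :-ℤ (conℤ (+ 2) :+ℤ i)) :+ℤ (conℤ (+ 2) :+ℤ j) :=ℤ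
      (x :-ℤ (conℤ (+ 1) :+ℤ i)) :+ℤ (conℤ (+ 1) :+ℤ j)) ≡.refl (+ x) (+ i) (+ j)

    index-top : ∀ p j → + suc p ℤ.- + 1 ℤ.+ + suc (suc j) ≡ + suc (suc p) ℤ.- + 1 ℤ.+ + suc j
    index-top p j = solveℤ 2 (λ p j →
      ((conℤ (+ 1) :+ℤ p) :-ℤ conℤ (+ 1)) :+ℤ (conℤ (+ 2) :+ℤ j) :=ℤ
      ((conℤ (+ 2) :+ℤ p) :-ℤ conℤ (+ 1)) :+ℤ (conℤ (+ 1) :+ℤ j)) ≡.refl (+ p) (+ j)

    index-corner : ∀ p → + suc p ℤ.- + 1 ℤ.+ + 1 ≡ + suc p
    index-corner p = solveℤ 1 (λ p → (p :-ℤ conℤ (+ 1)) :+ℤ conℤ (+ 1) :=ℤ p) ≡.refl (+ suc p)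

    index-negative : ∀ x d → + x ℤ.- + suc (suc (x ℕ.+ d)) ℤ.+ + 1 ≡ -[1+ d ]
    index-negative x d = solveℤ 2 (λ x d →
      (x :-ℤ (conℤ (+ 2) :+ℤ (x :+ℤ d))) :+ℤ conℤ (+ 1) :=ℤ :-ℤ (conℤ (+ 1) :+ℤ d)) ≡.refl (+ x) (+ d)

    τ₀ : ∀ a i → τ (+ 1 ℤ.- + 1) a i ≡ a i
    τ₀ a i = ≡.cong a (ℤₚ.+-identityʳ i)

  entry : List ℕ → Sequence → ℕ → ℕ → Λ
  entry μ a i j = hₘ (+ part μ i ℤ.- + suc i ℤ.+ + suc j) (τ (+ 1 ℤ.- + suc j) a)

  schur : ℕ → List ℕ → Sequence → Λ
  schur N μ a = detΛ N λ i j → entry μ a (toℕ i) (toℕ j)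

  -- The subscript is `part μ (suc i)` - i - 1, which the bound makes negative.
  entry-vanish : ∀ μ a {i} → part μ (suc i) ≤ i → entry μ a (suc i) 0 ≈Λ 0Λ
  entry-vanish μ a {i} le = hₘ-cong {a = τ (+ 1 ℤ.- + 1) a} (≡.trans
    (≡.cong (λ n → + part μ (suc i) ℤ.- + suc (suc n) ℤ.+ + 1) (≡.sym (ℕₚ.m+[n∸m]≡n le)))
    (index-negative (part μ (suc i)) (i ∸ part μ (suc i)))) (λ _ → ≡.refl)

  -- The subscript depends only on the difference of row and column, and the additional parameter
  -- shift of the later column is absorbed by `τ⁻¹`.
  entry-shift : ∀ x i j a →
    hₘ (+ x ℤ.- + suc (suc i) ℤ.+ + suc (suc j)) (τ (+ 1 ℤ.- + suc (suc j)) a) ≈Λ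
    hₘ (+ x ℤ.- + suc i ℤ.+ + suc j) (τ (+ 1 ℤ.- + suc j) (τ⁻¹ a))
  entry-shift x i j a = hₘ-cong (index-shift x i j) (τ-τ⁻¹ a j)

  schur-∷-minor : ∀ N x μ a →
    detΛ N (minor {N} (λ i j → entry (x ∷ μ) a (toℕ i) (toℕ j)) Fin.zero) ≈Λ schur N μ (τ⁻¹ a)
  schur-∷-minor N x μ a = detΛ-cong N λ i j → entry-shift (part μ (toℕ i)) (toℕ i) (toℕ j) a

  schur-empty : ∀ N a → schur N [] a ≈Λ 1Λ
  schur-empty zero    a xs = detΛ-zero (λ i j → entry [] a (toℕ i) (toℕ j)) xs
  schur-empty (suc N) a xs = begin
    coeff (schur (suc N) [] a) xs
      ≈⟨ detΛ-column N (λ i j → entry [] a (toℕ i) (toℕ j)) (λ i → entry-vanish [] a {toℕ i} z≤n) xs ⟩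
    conv (coeff 1Λ) (coeff (detΛ N (λ i j → entry [] a (suc (toℕ i)) (suc (toℕ j))))) xs
      ≈⟨ conv-identityˡ _ xs ⟩
    coeff (detΛ N (λ i j → entry [] a (suc (toℕ i)) (suc (toℕ j)))) xs
      ≈⟨ detΛ-cong N (λ i j → entry-shift 0 (toℕ i) (toℕ j) a) xs ⟩
    coeff (schur N [] (τ⁻¹ a)) xs  ≈⟨ schur-empty N (τ⁻¹ a) xs ⟩
    coeff 1Λ xs                 ∎

  entry-corner : ∀ p μ a → entry (suc p ∷ μ) a 0 0 ≈Λ hₘ (+ suc p) a
  entry-corner p μ a = hₘ-cong (index-corner p) (τ₀ a)

  schur-row : ∀ N p a → schur (suc N) (hook p 0) a ≈Λ hₘ (+ suc p) a
  schur-row N p a xs = begin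
    coeff (schur (suc N) (hook p 0) a) xs
      ≈⟨ detΛ-column N (λ i j → entry (hook p 0) a (toℕ i) (toℕ j))
           (λ i → entry-vanish (hook p 0) a {toℕ i} z≤n) xs ⟩
    conv (coeff (entry (hook p 0) a 0 0))
      (coeff (detΛ N (minor (λ i j → entry (hook p 0) a (toℕ i) (toℕ j)) Fin.zero))) xs
      ≈⟨ conv-cong (entry-corner p [] a)
           (λ ys → trans (schur-∷-minor N (suc p) [] a ys) (schur-empty N (τ⁻¹ a) ys)) xs ⟩
    conv (coeff (hₘ (+ suc p) a)) (coeff 1Λ) xs  ≈⟨ conv-comm (coeff (hₘ (+ suc p) a)) (coeff 1Λ) xs ⟩
    conv (coeff 1Λ) (coeff (hₘ (+ suc p) a)) xs  ≈⟨ conv-identityˡ _ xs ⟩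
    coeff (hₘ (+ suc p) a) xs                    ∎

  -- The first column is h_{p+1;a}, 1, 0, 0, .... Striking out row 1 leaves the matrix of (0 | q),
  -- and striking out row 2 leaves that of (p + 1 | q), both with parameters `τ⁻¹ a`.
  schur-hook-suc : ∀ N p q a → schur (suc (suc N)) (hook p (suc q)) a ≈Λ
    (hₘ (+ suc p) a *Λ schur (suc N) (hook 0 q) (τ⁻¹ a)) +Λ (-Λ schur (suc N) (hook (suc p) q) (τ⁻¹ a))
  schur-hook-suc N p q a xs = trans
    (detΛ-hessenberg N M (λ _ → refl)
      (λ i → entry-vanish (hook p (suc q)) a (part-ones q (toℕ i))) xs)
    (+-cong (conv-cong (entry-corner p (1 ∷ replicate q 1) a) (schur-∷-minor (suc N) (suc p) (hook 0 q) a) xs)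
      (-‿cong (detΛ-cong (suc N) lower xs)))
    where
    M : Fin (suc (suc N)) → Fin (suc (suc N)) → Λ
    M i j = entry (hook p (suc q)) a (toℕ i) (toℕ j)
    part-ones : ∀ q i → part (replicate q 1) i ≤ suc i
    part-ones zero    i       = z≤n
    part-ones (suc q) zero    = s≤s z≤n
    part-ones (suc q) (suc i) = ℕₚ.m≤n⇒m≤1+n (part-ones q i)
    lower : ∀ i j → minor M (Fin.suc Fin.zero) i j ≈Λ entry (hook (suc p) q) (τ⁻¹ a) (toℕ i) (toℕ j)
    -- The first row stays in place while its columns move left by one, so its part must grow from p
    -- + 1 to p + 2.
    lower Fin.zero    j = hₘ-cong (index-top p (toℕ j)) (τ-τ⁻¹ a (toℕ j))
    lower (Fin.suc i) j = entry-shift (part (replicate q 1) (toℕ i)) (suc (toℕ i)) (toℕ j) a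

  -- Induction on q for all p, a and N at once, since the recursion changes all of them. With P the
  -- product term, it remains to see that `G + Q` equals P.
  coeff-schur-hook : ∀ {N} p q a → q < N → ∀ xs → coeff (schur N (hook p q) a) xs ≈
    newton p (tail₁ a) (λ i → newton q (tail₁ (dual a)) (λ j → coeff (hookΛ i j) xs))
  coeff-schur-hook {suc N} p zero a _ xs = trans (schur-row N p a xs) (coeff-hₘ p a xs)
  coeff-schur-hook {suc (suc N)} p (suc q) a (s≤s q<N) xs = begin
    coeff (schur (suc (suc N)) (hook p (suc q)) a) xs  ≈⟨ schur-hook-suc N p q a xs ⟩
    P + - coeff (schur (suc N) (hook (suc p) q) (τ⁻¹ a)) xs
      ≈⟨ +-cong (trans P≈ (sym G+Q≈)) (-‿cong (coeff-schur-hook (suc p) q (τ⁻¹ a) q<N xs)) ⟩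
    (G + Q) + - Q                                   ≈⟨ +-assoc _ _ _ ⟩
    G + (Q + - Q)                                   ≈⟨ +-congˡ (-‿inverseʳ Q) ⟩
    G + 0#                                          ≈⟨ +-identityʳ G ⟩
    G                                               ∎
    where
    b d d′ : ℕ → 𝕂
    b = tail₁ a
    d = tail₁ (dual a)
    d′ = tail₁ (dual (τ⁻¹ a))
    a₀ : 𝕂
    a₀ = a (+ 0)
    L HE : ℕ → ℕ → 𝕂
    L i j = coeff (hookΛ i j) xs
    HE i j = conv (coeff (hΛ (suc i))) (coeff (eΛ (suc j))) xs
    M : ℕ → 𝕂
    M i = newton q d′ (L i)
    P Q G : 𝕂
    P = conv (coeff (hₘ (+ suc p) a)) (coeff (schur (suc N) (hook 0 q) (τ⁻¹ a))) xs
    -- The first node of `τ⁻¹ a` is a₀ and the others are `b`, so `Q` unfolds to `newton p b` of M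
    -- (i + 1) - a₀ M i.
    Q = newton (suc p) (tail₁ (τ⁻¹ a)) M
    G = newton p b (λ i → newton (suc q) d (L i))
    P≈ : P ≈ newton p b (λ i → newton q d′ (HE i))
    P≈ = begin
      P ≈⟨ conv-cong (coeff-hₘ p a) (λ ys → trans (coeff-schur-hook 0 q (τ⁻¹ a) q<N ys)
             (newton-cong q (λ _ → refl) λ j → hookΛ-column j ys)) xs ⟩
      conv (λ ys → newton p b (λ i → coeff (hΛ (suc i)) ys))
        (λ ys → newton q d′ (λ j → coeff (eΛ (suc j)) ys)) xs
        ≈⟨ conv-newtonˡ p b (λ i → coeff (hΛ (suc i))) _ xs ⟩
      newton p b (λ i → conv (coeff (hΛ (suc i))) (λ ys → newton q d′ (λ j → coeff (eΛ (suc j)) ys)) xs)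
        ≈⟨ newton-cong p (λ _ → refl) (λ i →
             conv-newtonʳ q d′ (coeff (hΛ (suc i))) (λ j → coeff (eΛ (suc j))) xs) ⟩
      newton p b (λ i → newton q d′ (HE i)) ∎
    -- The extra roots a₀ and - a₀ of the two polynomials cancel, since (x - a₀) + (y + a₀) = x + y.
    summand : ∀ i → newton (suc q) d (L i) + (M (suc i) + - a₀ * M i) ≈ newton q d′ (HE i)
    summand i = begin
      newton (suc q) d (L i) + (M (suc i) + - a₀ * M i)
        ≈⟨ +-congʳ (trans (newton-cong q (λ k → reflexive (dual-τ⁻¹ a k)) (λ _ → refl))
             (newton-linear q d′ (λ j → L i (suc j)) (- - a₀) (L i))) ⟩
      (X + - - a₀ * M i) + (M (suc i) + - a₀ * M i)
        ≈⟨ solve 5 (λ x n m y k → (x :+ n :* m) :+ (y :+ k :* m) := (x :+ y) :+ (n :+ k) :* m)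
             refl X (- - a₀) (M i) (M (suc i)) (- a₀) ⟩
      (X + M (suc i)) + (- - a₀ + - a₀) * M i
        ≈⟨ +-cong (sym (newton-+ q d′ (λ j → L i (suc j)) (L (suc i))))
             (trans (*-congʳ (-‿inverseˡ (- a₀))) (zeroˡ _)) ⟩
      newton q d′ (λ j → L i (suc j) + L (suc i) j) + 0#  ≈⟨ +-identityʳ _ ⟩
      newton q d′ (λ j → L i (suc j) + L (suc i) j)
        -- `hookΛ i (suc j)` is `HE i j` minus `hookΛ (suc i) j` by definition, so the added term
        -- cancels.
        ≈⟨ newton-cong q (λ _ → refl) (λ j → trans (+-assoc _ _ _)
             (trans (+-congˡ (-‿inverseˡ (L (suc i) j))) (+-identityʳ _))) ⟩
      newton q d′ (HE i) ∎
      where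
      X : 𝕂
      X = newton q d′ (λ j → L i (suc j))
    G+Q≈ : G + Q ≈ newton p b (λ i → newton q d′ (HE i))
    G+Q≈ = begin
      G + Q ≈⟨ newton-+ p b (λ i → newton (suc q) d (L i)) (λ i → M (suc i) + - a₀ * M i) ⟨
      newton p b (λ i → newton (suc q) d (L i) + (M (suc i) + - a₀ * M i))
        ≈⟨ newton-cong p (λ _ → refl) summand ⟩
      newton p b (λ i → newton q d′ (HE i)) ∎

  -- The value of the double sum.

  -- The coefficients of Σ s°(i|j) u⁻ⁱ⁻¹ v⁻ʲ⁻¹, the sum for every choice of a.
  hookSeries⁺ : ℕ → ℕ → Λ
  hookSeries⁺ (suc i) (suc j) = hookΛ i j
  hookSeries⁺ (suc i) zero    = 0Λ
  hookSeries⁺ zero    _       = 0Λ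

  hookSeries : Series₂
  hookSeries (+ i)    (+ j)    = hookSeries⁺ i j
  hookSeries (+ _)    -[1+ _ ] = 0Λ
  hookSeries -[1+ _ ] _        = 0Λ

  hookSeries-isSum : ∀ a (N : ℕ → ℕ → ℕ) → (∀ p q → length (hook p q) ≤ N p q) →
    hookSeries IsSumOf (λ p q → hookTerm (N p q) a p q)
  hookSeries-isSum a N le = isSum
    where
    b d : ℕ → 𝕂
    b = tail₁ a
    d = tail₁ (dual a)
    A B : ℕ → ℕ → 𝕂
    A p i = poles (suc p) b i
    B q j = poles (suc q) d j
    s : ℕ → ℕ → Λ
    s p q = sₘ (N p q) (hook p q) a
    term-zeroˡ : ∀ {i} p q j → i ≤ p → (A p i * B q j) • s p q ≈Λ 0Λ
    term-zeroˡ p q j i≤p xs = trans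
      (*-congʳ (trans (*-congʳ (poles-vanish b (s≤s i≤p))) (zeroˡ _))) (zeroˡ _)
    term-zeroʳ : ∀ {j} p q i → j ≤ q → (A p i * B q j) • s p q ≈Λ 0Λ
    term-zeroʳ p q i j≤q xs = trans
      (*-congʳ (trans (*-congˡ (poles-vanish d (s≤s j≤q))) (zeroʳ _))) (zeroˡ _)
    coeff-s : ∀ p q xs →
      coeff (s p q) xs ≈ newton p b (λ i → newton q d (λ j → coeff (hookΛ i j) xs))
    coeff-s p q xs = trans (det≈detΛ (N p q) _ xs) (coeff-schur-hook p q a
      (≡.subst (_≤ N p q) (≡.cong suc (length-replicate q)) (le p q)) xs)
    total : ∀ {n i j} → i < n → j < n → hookΛ i j ≈Λ
      ∑Λ {n} (λ p → ∑Λ {n} (λ q → (A (toℕ p) (suc i) * B (toℕ q) (suc j)) • s (toℕ p) (toℕ q)))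
    total {n} {i} {j} i<n j<n xs = sym (begin
      coeff (∑Λ {n} (λ p → ∑Λ {n} (λ q → F (toℕ p) (toℕ q)))) xs
        ≈⟨ trans (coeff-∑ n (λ p → ∑Λ {n} (λ q → F (toℕ p) (toℕ q))) xs)
             (sum-cong-≋ {n} λ p → coeff-∑ n (λ q → F (toℕ p) (toℕ q)) xs) ⟩
      ∑ {n} (λ p → ∑ {n} (λ q → coeff (F (toℕ p) (toℕ q)) xs))
        ≈⟨ sum-cong-≋ {n} (λ p → row (toℕ p)) ⟩
      newtonSum n (suc i) b (λ i → L i j)  ≈⟨ newton-expansion b (λ i → L i j) i<n ⟩
      L i j                                ∎)
      where
      F : ℕ → ℕ → Λ
      F p q = (A p (suc i) * B q (suc j)) • s p q
      L : ℕ → ℕ → 𝕂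
      L i j = coeff (hookΛ i j) xs
      row : ∀ p → ∑ {n} (λ q → coeff (F p (toℕ q)) xs) ≈ A p (suc i) * newton p b (λ i → L i j)
      row p = begin
        ∑ {n} (λ q → coeff (F p (toℕ q)) xs)
          -- Exchanging the functionals puts the one in y outside, so that the sum over q becomes a
          -- Newton sum with nodes `d`.
          ≈⟨ sum-cong-≋ {n} (λ q → trans (*-assoc _ _ _) (*-congˡ (*-congˡ
               (trans (coeff-s p (toℕ q) xs) (newton-comm p b (toℕ q) d L))))) ⟩
        ∑ {n} (λ q → A p (suc i) * (B (toℕ q) (suc j) * newton (toℕ q) d (λ j → newton p b (λ i → L i j))))
          ≈⟨ *-distribˡ-sum {n} (A p (suc i)) (λ q →
               B (toℕ q) (suc j) * newton (toℕ q) d (λ j → newton p b (λ i → L i j))) ⟨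
        A p (suc i) * newtonSum n (suc j) d (λ j → newton p b (λ i → L i j))
          ≈⟨ *-congˡ (newton-expansion d (λ j → newton p b (λ i → L i j)) j<n) ⟩
        A p (suc i) * newton p b (λ i → L i j) ∎
    isSum : hookSeries IsSumOf (λ p q → hookTerm (N p q) a p q)
    -- The bound i + j + 1 exceeds both i and j: smaller indices suffice for both interpolations,
    -- and from it on the poles have too high an order.
    isSum (+ suc i) (+ suc j) = suc (i ℕ.+ j) ,
      (λ { p q (inj₁ n≤p) → term-zeroˡ p q (suc j) (ℕₚ.≤-trans (s≤s (ℕₚ.m≤m+n i j)) n≤p)
         ; p q (inj₂ n≤q) → term-zeroʳ p q (suc i) (ℕₚ.≤-trans (s≤s (ℕₚ.m≤n+m j i)) n≤q) }) ,
      total (s≤s (ℕₚ.m≤m+n i j)) (s≤s (ℕₚ.m≤n+m j i))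
    -- Every term is divisible by u⁻¹ v⁻¹, so here and in the next case the empty sum is correct.
    isSum (+ suc i) (+ zero)  = 0 , (λ p q _ → term-zeroʳ p q (suc i) z≤n) , λ _ → refl
    isSum (+ zero)  (+ j)     = 0 , (λ p q _ → term-zeroˡ p q j z≤n) , λ _ → refl
    isSum (+ _)     -[1+ _ ]  = 0 , (λ _ _ _ _ → refl) , λ _ → refl
    isSum -[1+ _ ]  _         = 0 , (λ _ _ _ _ → refl) , λ _ → refl

  -- Multiplication by u + v.

  private
    zero-sum : ∀ {x y z} → x ≈ 0# → y ≈ 0# → z ≈ 0# → x + (y + z) ≈ 0#
    zero-sum p q r = trans (+-cong p (trans (+-cong q r) (+-identityˡ _))) (+-identityˡ _)

    conv-identityʳ : ∀ f xs → conv f (coeff 1Λ) xs ≈ f xs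
    conv-identityʳ f xs = trans (conv-comm f (coeff 1Λ) xs) (conv-identityˡ f xs)

  -- In the interior the recursion defining `hookΛ` cancels one hook and leaves h e; on the borders
  -- a single row or column remains, equal to h or e.
  hookSeries⁺-equation : ∀ i j →
    1₂ (+ i) (+ j) +Λ (hookSeries⁺ (suc i) j +Λ hookSeries⁺ i (suc j)) ≈Λ H i *Λ E j
  hookSeries⁺-equation zero    zero    xs =
    trans (+-congˡ (+-identityˡ _)) (trans (+-identityʳ _) (sym (conv-identityˡ (coeff 1Λ) xs)))
  hookSeries⁺-equation zero    (suc j) xs = trans (+-identityˡ _) (trans (+-identityʳ _)
    (trans (hookΛ-column j xs) (sym (conv-identityˡ (coeff (eΛ (suc j))) xs))))
  hookSeries⁺-equation (suc i) zero    xs = trans (+-identityˡ _) (trans (+-identityˡ _)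
    (sym (conv-identityʳ (coeff (hΛ (suc i))) xs)))
  hookSeries⁺-equation (suc i) (suc j) xs = trans (+-identityˡ _) (trans
    (sym (+-assoc _ _ _)) (xyx⁻¹≈y (coeff (hookΛ (suc i) j) xs) _))

  hookSeries-equation : 1₂ +₂ ([u+v]· hookSeries) ≈₂ (H ⊗ E)
  hookSeries-equation (+ i) (+ j) xs = trans
    (+-congˡ (+-cong (reflexive (≡.cong (λ k → coeff (hookSeries⁺ k j) xs) (ℕₚ.+-comm i 1)))
                     (reflexive (≡.cong (λ k → coeff (hookSeries⁺ i k) xs) (ℕₚ.+-comm j 1)))))
    (hookSeries⁺-equation i j xs)
  -- From exponent -1 the shift reaches exponent 0, where `hookSeries` still vanishes, so no
  -- positive power of u or v is created.
  hookSeries-equation (+ zero)  -[1+ zero ]  xs = zero-sum refl refl refl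
  hookSeries-equation (+ suc i) -[1+ zero ]  xs = zero-sum refl refl refl
  hookSeries-equation (+ zero)  -[1+ suc _ ] xs = zero-sum refl refl refl
  hookSeries-equation (+ suc i) -[1+ suc _ ] xs = zero-sum refl refl refl
  hookSeries-equation -[1+ zero ]  (+ _)     xs = zero-sum refl refl refl
  hookSeries-equation -[1+ zero ]  -[1+ _ ]  xs = zero-sum refl refl refl
  hookSeries-equation -[1+ suc _ ] _         xs = zero-sum refl refl refl

theorem6 : {c ℓ : Level} (K : CommutativeRing c ℓ) → let open Symmetric K in
    (a : Sequence)
    (N : ℕ → ℕ → ℕ) → (∀ p q → length (hook p q) ≤ N p q) →
    ∃[ S ] (S IsSumOf (λ p q → hookTerm (N p q) a p q)) × (1₂ +₂ ([u+v]· S) ≈₂ (H ⊗ E))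
theorem6 K a N le = hookSeries , hookSeries-isSum a N le , hookSeries-equation
  where open HookSeries K
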